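{- Let $(\mathcal N,\mathcal O,\mathfrak l)$ be an acyclically oriented plabic network, which possesses neither internal sources nor internal sinks, representing a point in an irreducible positroid cell, where $\mathcal O=\mathcal O(I)$. Then all edge vectors $E_e$ (both the internal and the boundary ones) are non-null. Moreover, in this case $$E_e=\sum_{j\in\bar I}\Big(\sum_{F\in\mathcal F_{e,b_j}(\mathcal G)}(-1)^{\mathrm{wind}(F)+\mathrm{int}(F)}w(F)\Big)E_j=\sum_{j\in\bar I}\Big((-1)^{\sigma(e,b_j)}\sum_{F\in\mathcal F_{e,b_j}(\mathcal G)}w(F)\Big)E_j,$$ where $E_j$ is the $j$-th canonical basis vector, the inner sums run over all directed paths $F$ starting at $e$ and ending at $b_j$, and the parity $\sigma(e,b_j)$ of $\mathrm{wind}(F)+\mathrm{int}(F)$ is the same for all such $F$. In particular, this formula holds for all edges of Le-networks representing points in irreducible positroid cells.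
   Context: **Plabic networks.** Let $D$ be a closed convex disk whose boundary contains a straight segment. A plabic graph $\mathcal G$ is a finite directed planar graph embedded in $D$ with straight edges. It has boundary vertices $b_1,\dots,b_n$ on the segment, labelled clockwise, each of degree 1 (a source if its edge is outgoing, a sink otherwise). The remaining (internal) vertices lie inside $D$ and have degree 2 or 3. No component is isolated from the boundary. The graph is perfect: each internal vertex has exactly one incoming edge (then it is white) or exactly one outgoing edge (then it is black); bivalent vertices have one incoming and one outgoing edge and either color. The orientation is called a perfect orientation. $I$ is the set of indices of the boundary sources, $\bar I=[n]\setminus I$, $\mathcal O=\mathcal O(I)$. A network $\mathcal N$ has a positive weight $w_e$ on each edge. Acyclically oriented: there are no directed cycles. **Positroid cell.** $\mathcal M$ is the set of source sets of all perfect orientations of $\mathcal G$ compatible with the coloring. The network represents (via Postnikov's boundary measurement map) a point of the cell $\mathcal S^{\mathrm{TNN}}_{\mathcal M}$ of points of $Gr^{\mathrm{TNN}}(k,n)$ with $\Delta_J>0$ for $J\in\mathcal M$ and $\Delta_J=0$ otherwise. The cell is irreducible if for every $j\in[n]$ there are $J,J'\in\mathcal M$ with $j\in J$, $j\notin J'$. **Gauge rays.** A gauge ray direction $\mathfrak l$ is an oriented direction, not parallel to any edge, such that the rays with direction $\mathfrak l$ starting at boundary vertices point inside $D$ and contain no internal vertices. The gauge rays are those starting at the boundary sources, and $\mathrm{int}(e)$ is the number of their intersections with $e$ (base points not counted). **Winding.** $s(a,b)=+1,0,-1$ if the ordered pair $(a,b)$ is positively oriented, parallel, negatively oriented. For consecutive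 directed edges: $\mathrm{wind}(e,f)=\pm1$ if $s(e,f)=s(e,\mathfrak l)=s(\mathfrak l,f)=\pm1$; otherwise $0$. **Edge vectors.** For a directed path $\mathcal P=(e_1,\dots,e_m)$: $w(\mathcal P)=\prod_lw_{e_l}$, $\mathrm{wind}(\mathcal P)=\sum_{l<m}\mathrm{wind}(e_l,e_{l+1})$, $\mathrm{int}(\mathcal P)=\sum_l\mathrm{int}(e_l)$. $E_e\in\mathbb R^n$ has components $(E_e)_j=\sum_{\mathcal P:e\to b_j}(-1)^{\mathrm{wind}(\mathcal P)+\mathrm{int}(\mathcal P)}w(\mathcal P)$ over all directed paths with first edge $e$ ending at $b_j$ (zero if none). In the acyclic case the sum is finite, and $\mathcal F_{e,b_j}(\mathcal G)$ (the edge flows from $e$ to $b_j$) is exactly the set of these paths. **Le-networks.** The (acyclically oriented, perfect) plabic networks associated by Postnikov to Le-diagrams. A Le-diagram is a filling of a Young diagram inside a $k\times(n-k)$ rectangle by 0s and 1s in which no 0 has both a 1 to its left in the same row and a 1 above it in the same column. The boundary vertices are the steps of the southeast border labelled from northeast to southwest (vertical steps are sources, horizontal steps are sinks). From each source a line goes left through the 1s of its row, and from each 1 a line goes down through the 1s of its column to the sink of that column. Horizontal edges are directed leftwards and vertical ones downwards, and each vertex with two incoming and two outgoing edges is resolved into a black vertex (collecting the incoming edges) followed by a white vertex (splitting into the outgoing edges). -}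

module Defs where

open import Level using (0ℓ)
open import Algebra.Bundles using (CommutativeRing)
import Algebra.Properties.Ring as RingProperties
import Algebra.Solver.Ring.NaturalCoefficients.Default as NatSolver
open import Data.Bool.Base using (Bool; true; false; if_then_else_)
import Data.Bool.Properties as Bool
open import Data.Fin.Base as Fin using (Fin; zero; suc; toℕ)
import Data.Fin.Properties as Fin
open import Data.Fin.Subset using (Subset; ∁; _∈_; _∉_)
open import Data.Fin.Subset.Properties using (_∈?_)
open import Data.Integer.Base as ℤ using (ℤ; 0ℤ; 1ℤ; -1ℤ; ∣_∣)
import Data.Integer.Properties as ℤ
open import Data.List.Base
  using (List; []; _∷_; _++_; length; map; filter; foldr; concatMap; allFin)
import Data.List.Membership.Propositional as List
import Data.List.Membership.Propositional.Properties as List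
import Data.List.Relation.Unary.All as All
import Data.List.Relation.Unary.All.Properties as All
import Data.List.Relation.Unary.AllPairs as AllPairs
import Data.List.Relation.Unary.AllPairs.Properties as AllPairs
open import Data.List.Relation.Unary.Any as Any using (here)
open import Data.List.Relation.Unary.Unique.Propositional using (Unique)
import Data.List.Relation.Unary.Unique.Propositional.Properties as Unique
open import Data.Nat.Base as ℕ using (ℕ; zero; suc; _∸_; z≤n; s≤s)
import Data.Nat.Properties as ℕ
open import Data.Parity.Base using (Parity; 0ℙ; 1ℙ)
open import Data.Product.Base using (∃; ∃₂; _×_; _,_; proj₁; proj₂)
open import Data.Sum.Base using (_⊎_; inj₁; inj₂)
open import Data.Sum.Properties using (≡-dec)
import Data.Vec.Base as Vec
open import Function.Definitions using (Bijective)
open import Relation.Binary.Construct.Closure.Equivalence using (EqClosure)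
open import Relation.Binary.Definitions
  using (DecidableEquality; tri<; tri≈; tri>)
open import Relation.Binary.PropositionalEquality
  using (_≡_; _≢_; refl; sym; trans; cong; subst)
open import Axiom.UniquenessOfIdentityProofs.WithK using (uip)
open import Relation.Binary.Structures using (IsStrictTotalOrder)
open import Relation.Nullary.Decidable
  using (Dec; yes; no; does; ¬?; _×-dec_; _⊎-dec_; map′; True)
open import Relation.Nullary.Negation using (¬_; contradiction)

-- The standard library has no real numbers.  They are axiomatised as a
-- Dedekind-complete totally ordered field, which classically determines ℝ
-- up to unique isomorphism; the order is trichotomous, as in classical
-- mathematics.
record RealField : Set₁ where
  infix 4 _<_ _≤_
  field
    commutativeRing : CommutativeRing 0ℓ 0ℓ

  open CommutativeRing commutativeRing public

  field
    _<_                : Carrier → Carrier → Set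
    isStrictTotalOrder : IsStrictTotalOrder _≈_ _<_
    0<1                : 0# < 1#
    +-monoʳ-<          : ∀ x {y z} → y < z → x + y < x + z
    *-pos              : ∀ {x y} → 0# < x → 0# < y → 0# < x * y
    invertible         : ∀ x → ¬ (x ≈ 0#) → ∃ λ y → x * y ≈ 1#

  _≤_ : Carrier → Carrier → Set
  x ≤ y = x < y ⊎ x ≈ y

  UpperBound : (Carrier → Set) → Carrier → Set
  UpperBound P b = ∀ x → P x → x ≤ b

  field
    supremum : (P : Carrier → Set) → ∃ P → ∃ (UpperBound P) →
               ∃ λ s → UpperBound P s × (∀ b → UpperBound P b → s ≤ b)

  open IsStrictTotalOrder isStrictTotalOrder public
    using (compare; _≟_; _<?_; <-respˡ-≈; <-respʳ-≈)

data Colour : Set where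
  white black : Colour

record Digraph (n : ℕ) : Set where
  field
    #internal : ℕ
    #edges    : ℕ

  Edge : Set
  Edge = Fin #edges

  Vertex : Set
  Vertex = Fin n ⊎ Fin #internal

  field
    src tgt : Edge → Vertex
    colour  : Fin #internal → Colour

  boundary : Fin n → Vertex
  boundary = inj₁

  internal : Fin #internal → Vertex
  internal = inj₂

  _≟ᵥ_ : DecidableEquality Vertex
  _≟ᵥ_ = ≡-dec Fin._≟_ Fin._≟_

  indegree outdegree degree : Vertex → ℕ
  indegree  v = length (filter (λ e → tgt e ≟ᵥ v) (allFin #edges))
  outdegree v = length (filter (λ e → src e ≟ᵥ v) (allFin #edges))
  degree    v = indegree v ℕ.+ outdegree v

  Adjacent : Vertex → Vertex → Set
  Adjacent u v = ∃ λ e → src e ≡ u × tgt e ≡ v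

  Perfect : Set
  Perfect = ∀ v → (colour v ≡ white → indegree  (internal v) ≡ 1)
                × (colour v ≡ black → outdegree (internal v) ≡ 1)

  sources : Subset n
  sources = Vec.tabulate λ j → does (Fin.any? λ e → src e ≟ᵥ boundary j)

  NoInternalSourcesOrSinks : Set
  NoInternalSourcesOrSinks =
    ∀ v → indegree (internal v) ≢ 0 × outdegree (internal v) ≢ 0

-- A bivalent vertex of a perfect graph has one incoming and one outgoing
-- edge whichever its colour.
record IsPlabic {n} (G : Digraph n) : Set where
  open Digraph G
  field
    boundary-degree : ∀ j → degree (boundary j) ≡ 1
    internal-degree : ∀ v → degree (internal v) ≡ 2 ⊎ degree (internal v) ≡ 3
    perfect         : Perfect
    connected       : ∀ v → ∃ λ j → EqClosure Adjacent v (boundary j)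

-- The matroid consists of the source sets of the perfect orientations
-- compatible with the colouring; an orientation is given by the set o of
-- edges to reverse.
reorient : ∀ {n} (G : Digraph n) → (Digraph.Edge G → Bool) → Digraph n
reorient G o = record
  { #internal = #internal
  ; #edges    = #edges
  ; src       = λ e → if o e then tgt e else src e
  ; tgt       = λ e → if o e then src e else tgt e
  ; colour    = colour
  } where open Digraph G

_∈Matroid_ : ∀ {n} → Subset n → Digraph n → Set
J ∈Matroid G = ∃ λ o → Digraph.Perfect (reorient G o)
                     × Digraph.sources (reorient G o) ≡ J

Irreducible : ∀ {n} → Digraph n → Set
Irreducible G = ∀ j → (∃ λ J → J ∈Matroid G × j ∈ J)
                    × (∃ λ J → J ∈Matroid G × j ∉ J)

module _ {n} (G : Digraph n) where
  open Digraph G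

  -- Path e v: the index e is the first edge, v the final vertex.
  infixr 5 _∷_
  data Path : Edge → Vertex → Set where
    [_] : ∀ {e v} → tgt e ≡ v → Path e v
    _∷_ : ∀ {e f v} → tgt e ≡ src f → Path f v → Path e v

  Acyclic : Set
  Acyclic = ∀ e → ¬ Path e (src e)

module _ {n} {G : Digraph n} where
  open Digraph G

  private
    ending : ∀ {e v} → Dec (tgt e ≡ v) → List (Path G e v)
    ending (yes p) = [ p ] ∷ []
    ending (no  _) = []

    extend : ∀ {e f v} → Dec (tgt e ≡ src f) → List (Path G f v) →
             List (Path G e v)
    extend (yes p) ps = map (p ∷_) ps
    extend (no  _) _  = []

  pathsUpTo : ℕ → ∀ e v → List (Path G e v)
  pathsUpTo zero    e v = []
  pathsUpTo (suc k) e v =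
    ending (tgt e ≟ᵥ v) ++
    concatMap (λ f → extend (tgt e ≟ᵥ src f) (pathsUpTo k f v))
              (allFin #edges)

  -- In an acyclic graph a path repeats no edge, so these are all the paths,
  -- each listed once (see paths-complete and paths-unique); the list is not
  -- meaningful for graphs with directed cycles.
  paths : ∀ e v → List (Path G e v)
  paths = pathsUpTo #edges

  private
    len : ∀ {e v} → Path G e v → ℕ
    len [ _ ]   = 1
    len (_ ∷ q) = suc (len q)

    nth : ∀ {e v} (q : Path G e v) → Fin (len q) → Edge
    nth {e} [ _ ]   zero    = e
    nth {e} (_ ∷ q) zero    = e
    nth     (_ ∷ q) (suc i) = nth q i

    before : ∀ {e v} (q : Path G e v) (j : Fin (len q)) →
             Path G e (src (nth q j)) ⊎ e ≡ nth q j
    before [ _ ]   zero    = inj₂ refl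
    before (_ ∷ q) zero    = inj₂ refl
    before (p ∷ q) (suc j) with before q j
    ... | inj₁ r  = inj₁ (p ∷ r)
    ... | inj₂ eq = inj₁ [ trans p (cong src eq) ]

    segment : ∀ {e v} (q : Path G e v) (i j : Fin (len q)) → i Fin.< j →
              Path G (nth q i) (src (nth q j))
    segment [ _ ] zero zero ()
    segment (p ∷ q) zero (suc j) _ with before q j
    ... | inj₁ r  = p ∷ r
    ... | inj₂ eq = [ trans p (cong src eq) ]
    segment (_ ∷ q) (suc i) (suc j) (s≤s i<j) = segment q i j i<j

    len≤ : Acyclic G → ∀ {e v} (q : Path G e v) → len q ℕ.≤ #edges
    len≤ acyclic q with len q ℕ.≤? #edges
    ... | yes l≤m = l≤m
    ... | no  l≰m with Fin.pigeonhole (ℕ.≰⇒> l≰m) (nth q)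
    ...   | i , j , i<j , eq =
      contradiction (subst (λ f → Path G (nth q i) (src f)) (sym eq)
                           (segment q i j i<j))
                    (acyclic (nth q i))

    complete : ∀ k {e v} (q : Path G e v) → len q ℕ.≤ k → q List.∈ pathsUpTo k e v
    complete (suc k) {e} {v} [ p ] _ = List.∈-++⁺ˡ (go (tgt e ≟ᵥ v))
      where
      go : ∀ d → [ p ] List.∈ ending d
      go (yes r) = here (cong [_] (uip p r))
      go (no ¬p) = contradiction p ¬p
    complete (suc k) {e} {v} (_∷_ {f = f} p q) (s≤s l≤k) =
      List.∈-++⁺ʳ (ending (tgt e ≟ᵥ v))
        (List.∈-concatMap⁺ (λ g → extend (tgt e ≟ᵥ src g) (pathsUpTo k g v))
          (Any.map (λ { refl → go (tgt e ≟ᵥ src f) }) (List.∈-allFin f)))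
      where
      go : ∀ d → (p ∷ q) List.∈ extend d (pathsUpTo k f v)
      go (yes r) with refl ← uip p r =
        List.∈-map⁺ (p ∷_) (complete k q l≤k)
      go (no ¬p) = contradiction p ¬p

    unique : ∀ k e v → Unique (pathsUpTo k e v)
    unique zero    e v = AllPairs.[]
    unique (suc k) e v = Unique.++⁺ (single (tgt e ≟ᵥ v))
      (Unique.concat⁺
        (All.map⁺ (All.universal (λ f → each f (tgt e ≟ᵥ src f)) (allFin #edges)))
        (AllPairs.map⁺ (AllPairs.map
          (λ f≢g {_} → apart f≢g (tgt e ≟ᵥ _) (tgt e ≟ᵥ _)) (Unique.allFin⁺ #edges))))
      (λ (x , y) → split (tgt e ≟ᵥ v) x (Any.satisfied (List.∈-concatMap⁻ (λ f → Ext f (tgt e ≟ᵥ src f)) {xs = allFin #edges} y)))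
      where
      Ext : ∀ f → Dec (tgt e ≡ src f) → List (Path G e v)
      Ext f d = extend {f = f} d (pathsUpTo k f v)
      single : ∀ d → Unique (ending {e} {v} d)
      single (yes _) = All.[] AllPairs.∷ AllPairs.[]
      single (no  _) = AllPairs.[]
      each : ∀ f d → Unique (Ext f d)
      each f (yes p) = Unique.map⁺ (λ { refl → refl }) (unique k f v)
      each f (no  _) = AllPairs.[]
      apart : ∀ {f g} → f ≢ g → ∀ d d′ {x} → ¬ (x List.∈ Ext f d × x List.∈ Ext g d′)
      apart f≢g (yes p) (yes r) (x∈ , y∈)
        with List.∈-map⁻ (p ∷_) x∈ | List.∈-map⁻ (r ∷_) y∈
      ... | _ , _ , refl | _ , _ , refl = f≢g refl
      split : ∀ d {x} → x List.∈ ending d → ¬ (∃ λ f → x List.∈ Ext f (tgt e ≟ᵥ src f))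
      split (yes p) (here refl) (f , y) with tgt e ≟ᵥ src f
      ... | yes r with List.∈-map⁻ (r ∷_) y
      ...   | _ , _ , ()

  paths-complete : Acyclic G → ∀ {e v} (q : Path G e v) → q List.∈ paths e v
  paths-complete acyclic q = complete #edges q (len≤ acyclic q)

  paths-unique : ∀ e v → Unique (paths e v)
  paths-unique = unique #edges

-- Rows are numbered from the top and columns from the left, starting at 0.
-- Positions outside the Young diagram are never filled by a 1 (true).
record LeDiagram (k m : ℕ) : Set where
  field
    shape            : Fin k → ℕ
    shape≤m          : ∀ r → shape r ℕ.≤ m
    shape-decreasing : ∀ {r r′} → r Fin.≤ r′ → shape r′ ℕ.≤ shape r
    filling          : Fin k → Fin m → Bool

  One : Fin k → Fin m → Set
  One r c = filling r c ≡ true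

  OneToLeft : Fin k → Fin m → Set
  OneToLeft r c = ∃ λ c′ → c′ Fin.< c × One r c′

  OneAbove : Fin k → Fin m → Set
  OneAbove r c = ∃ λ r′ → r′ Fin.< r × One r′ c

  field
    support     : ∀ {r c} → One r c → toℕ c ℕ.< shape r
    le-property : ∀ {r c} → toℕ c ℕ.< shape r → filling r c ≡ false →
                  ¬ (OneToLeft r c × OneAbove r c)

  Crossing : Fin k → Fin m → Set
  Crossing r c = One r c × OneToLeft r c × OneAbove r c

  one? : ∀ r c → Dec (One r c)
  one? r c = filling r c Bool.≟ true

  crossing? : ∀ r c → Dec (Crossing r c)
  crossing? r c = one? r c ×-dec
    Fin.any? (λ c′ → c′ Fin.<? c ×-dec one? r c′) ×-dec
    Fin.any? (λ r′ → r′ Fin.<? r ×-dec one? r′ c)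

  columnHeight : Fin m → ℕ
  columnHeight c = length (filter (λ r → toℕ c ℕ.<? shape r) (allFin k))

  -- Labels, counted from 0, of the steps of the southeast border read from
  -- northeast to southwest: before the vertical step of row r come the
  -- m ∸ shape r columns beyond its end and the rows above it; before the
  -- horizontal step of column c come the columns to its right and the
  -- columnHeight c rows that meet it.
  rowLabel : Fin k → ℕ
  rowLabel r = (m ∸ shape r) ℕ.+ toℕ r

  columnLabel : Fin m → ℕ
  columnLabel c = (m ∸ suc (toℕ c)) ℕ.+ columnHeight c

data ArcKind : Set where
  horizontal vertical diagonal : ArcKind

-- By the Le-property the lines cross only at boxes filled by 1.  Every such
-- box has an incoming edge from the right and an outgoing edge downwards;
-- it carries two vertices if it also has an incoming edge from above and
-- an outgoing one to the left, and a single vertex otherwise.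
module _ {k m} (L : LeDiagram k m) where
  open LeDiagram L

  data LeVertex : Set where
    source      : Fin k → LeVertex
    sink        : Fin m → LeVertex
    single      : ∀ r c → True (one? r c) → True (¬? (crossing? r c)) → LeVertex
    black white : ∀ r c → True (crossing? r c) → LeVertex

  -- The vertex of box (r , c) that collects, resp. emits, the edges.
  data Entry (r : Fin k) (c : Fin m) : LeVertex → Set where
    single : ∀ {p q} → Entry r c (single r c p q)
    black  : ∀ {p} → Entry r c (black r c p)

  data Exit (r : Fin k) (c : Fin m) : LeVertex → Set where
    single : ∀ {p q} → Exit r c (single r c p q)
    white  : ∀ {p} → Exit r c (white r c p)

  data LeArc : ArcKind → LeVertex → LeVertex → Set where
    from-source : ∀ {r c v} → Entry r c v →
      (∀ c′ → c Fin.< c′ → ¬ One r c′) →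
      LeArc horizontal (source r) v
    leftwards : ∀ {r c c′ u v} → Exit r c u → Entry r c′ v → c′ Fin.< c →
      (∀ d → c′ Fin.< d → d Fin.< c → ¬ One r d) →
      LeArc horizontal u v
    downwards : ∀ {r r′ c u v} → Exit r c u → Entry r′ c v → r Fin.< r′ →
      (∀ s → r Fin.< s → s Fin.< r′ → ¬ One s c) →
      LeArc vertical u v
    to-sink : ∀ {r c u} → Exit r c u →
      (∀ r′ → r Fin.< r′ → ¬ One r′ c) →
      LeArc vertical u (sink c)
    resolved : ∀ {r c p q} → LeArc diagonal (black r c p) (white r c q)

  -- Counterclockwise rank, starting from east, of the side on which an arc
  -- of the diagram leaves its tail or arrives at its head: E, NE, N, W, SW, S.
  -- The white vertex of a box lies to the southwest of the black one.
  leave arrive : ArcKind → ℕ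
  arrive horizontal = 0
  arrive diagonal   = 1
  arrive vertical   = 2
  leave  horizontal = 3
  leave  diagonal   = 4
  leave  vertical   = 5

  -- Dart u v ρ: an arc joins u and v, on the side of u of rank ρ.
  data Dart (u v : LeVertex) : ℕ → Set where
    outgoing : ∀ {κ} → LeArc κ u v → Dart u v (leave κ)
    incoming : ∀ {κ} → LeArc κ v u → Dart u v (arrive κ)

parityℤ : ℤ → Parity
parityℤ z = ℕ.parity ∣ z ∣

module Networks (ℝ : RealField) where
  open RealField ℝ
    hiding (zero) renaming (refl to ≈-refl; sym to ≈-sym; trans to ≈-trans)

  Point : Set
  Point = Carrier × Carrier

  infix  4 _≈ₚ_
  infixl 6 _+ₚ_ _-ₚ_
  infixr 7 _·_

  _≈ₚ_ : Point → Point → Set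
  (x , y) ≈ₚ (x′ , y′) = x ≈ x′ × y ≈ y′

  _+ₚ_ : Point → Point → Point
  (x , y) +ₚ (x′ , y′) = x + x′ , y + y′

  _-ₚ_ : Point → Point → Point
  (x , y) -ₚ (x′ , y′) = x - x′ , y - y′

  _·_ : Carrier → Point → Point
  t · (x , y) = t * x , t * y

  cross : Point → Point → Carrier
  cross (x , y) (x′ , y′) = x * y′ - y * x′

  -- Positive orientation is counterclockwise.
  s : Point → Point → ℤ
  s a b with compare (cross a b) 0#
  ... | tri< _ _ _ = -1ℤ
  ... | tri≈ _ _ _ = 0ℤ
  ... | tri> _ _ _ = 1ℤ

  -- Three directions (pairwise distinct) in counterclockwise cyclic order.
  Counterclockwise : Point → Point → Point → Set
  Counterclockwise a b c =
      (0# < cross a b × 0# < cross b c)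
    ⊎ (0# < cross b c × 0# < cross c a)
    ⊎ (0# < cross c a × 0# < cross a b)

  InUnitInterval : Carrier → Set
  InUnitInterval t = 0# ≤ t × t ≤ 1#

  Near : Carrier → Point → Point → Set
  Near ε (x , y) (x′ , y′) =
    (- ε < x′ - x × x′ - x < ε) × (- ε < y′ - y × y′ - y < ε)

  -- A closed convex disk (compact convex set with non-empty interior) with
  -- a straight segment in its boundary.  The segment is traversed from
  -- start to end in the clockwise direction, so the interior lies on its
  -- right.
  record Disk : Set₁ where
    field
      D : Point → Set

    Interior : Point → Set
    Interior x = ∃ λ ε → 0# < ε × (∀ y → Near ε x y → D y)

    field
      respects  : ∀ {x y} → x ≈ₚ y → D x → D y
      convex    : ∀ x y t → D x → D y → InUnitInterval t → D (x +ₚ t · (y -ₚ x))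
      closed    : ∀ x → ¬ D x → ∃ λ ε → 0# < ε × (∀ y → Near ε x y → ¬ D y)
      bounded   : ∃ λ M → ∀ x → D x → Near M (0# , 0#) x
      fat       : ∃ Interior
      start end : Point
      proper    : ¬ (start ≈ₚ end)

    onSegment : Carrier → Point
    onSegment t = start +ₚ t · (end -ₚ start)

    field
      segment⊆D  : ∀ t → InUnitInterval t → D (onSegment t)
      segment⊆∂D : ∀ t → InUnitInterval t → ¬ Interior (onSegment t)
      clockwise  : ∀ x → Interior x → cross (end -ₚ start) (x -ₚ start) < 0#

  record Drawing {n} (disk : Disk) (G : Digraph n) : Set where
    open Disk disk
    open Digraph G
    field
      pos : Vertex → Point

    OnEdge : Point → Edge → Set
    OnEdge x e = ∃ λ t → InUnitInterval t ×
                 x ≈ₚ pos (src e) +ₚ t · (pos (tgt e) -ₚ pos (src e))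

    Endpoint : Vertex → Edge → Set
    Endpoint v e = v ≡ src e ⊎ v ≡ tgt e

    direction : Edge → Point
    direction e = pos (tgt e) -ₚ pos (src e)

    field
      pos-injective     : ∀ {u v} → pos u ≈ₚ pos v → u ≡ v
      parameter         : Fin n → Carrier
      parameter-unit    : ∀ j → InUnitInterval (parameter j)
      parameter-mono    : ∀ {i j} → i Fin.< j → parameter i < parameter j
      boundary-position : ∀ j → pos (boundary j) ≈ₚ onSegment (parameter j)
      internal-position : ∀ v → Interior (pos (internal v))
      no-loops          : ∀ e → src e ≢ tgt e
      vertices-on-edges : ∀ v e → OnEdge (pos v) e → Endpoint v e
      edges-disjoint    : ∀ {e f} → e ≢ f → ∀ x → OnEdge x e → OnEdge x f →
                          ∃ λ v → Endpoint v e × Endpoint v f × x ≈ₚ pos v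

  record PlabicNetwork (n : ℕ) : Set₁ where
    field
      disk            : Disk
      graph           : Digraph n
      isPlabic        : IsPlabic graph
      drawing         : Drawing disk graph
      weight          : Digraph.Edge graph → Carrier
      weight-positive : ∀ e → 0# < weight e

    open Digraph graph public
    open Drawing drawing public

  record GaugeRayDirection {n} (N : PlabicNetwork n) : Set where
    open PlabicNetwork N
    open Disk disk using (Interior)
    field
      𝔩                    : Point
      nonzero              : ¬ (𝔩 ≈ₚ (0# , 0#))
      not-parallel         : ∀ e → ¬ (cross 𝔩 (direction e) ≈ 0#)
      pointing-inside      : ∀ j → ∃ λ t → 0# < t × Interior (pos (boundary j) +ₚ t · 𝔩)
      no-internal-vertices : ∀ j v t → 0# ≤ t →
                             ¬ (pos (internal v) ≈ₚ pos (boundary j) +ₚ t · 𝔩)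

  -- The open ray from b in direction l meets the segment from a to a + d.
  RayMeets : (b l a d : Point) → Set
  RayMeets b l a d = ∃₂ λ t u → 0# < t × InUnitInterval u × b +ₚ t · l ≈ₚ a +ₚ u · d

  private
    open RingProperties ring using (+-cancelʳ)
    open NatSolver commutativeSemiring
      using (solve; _:=_; _:+_; _:*_)
    open import Relation.Binary.Reasoning.Setoid setoid

    sub-add : ∀ x y → (x - y) + y ≈ x
    sub-add x y = begin
      (x - y) + y     ≈⟨ +-assoc x (- y) y ⟩
      x + (- y + y)   ≈⟨ +-congˡ (-‿inverseˡ y) ⟩
      x + 0#          ≈⟨ +-identityʳ x ⟩
      x               ∎

    move : ∀ {a b p q} → b + p ≈ a + q → p ≈ (a - b) + q
    move {a} {b} {p} {q} eq = +-cancelʳ b _ _ (begin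
      p + b               ≈⟨ +-comm p b ⟩
      b + p               ≈⟨ eq ⟩
      a + q               ≈⟨ +-congʳ (sub-add a b) ⟨
      ((a - b) + b) + q   ≈⟨ solve 3 (λ w y z → (w :+ y) :+ z := (w :+ z) :+ y) ≈-refl (a - b) b q ⟩
      ((a - b) + q) + b   ∎)

    unmove : ∀ {a b p q} → p ≈ (a - b) + q → b + p ≈ a + q
    unmove {a} {b} {p} {q} eq = begin
      b + p               ≈⟨ +-congˡ eq ⟩
      b + ((a - b) + q)   ≈⟨ solve 3 (λ w y z → y :+ (w :+ z) := (w :+ y) :+ z) ≈-refl (a - b) b q ⟩
      ((a - b) + b) + q   ≈⟨ +-congʳ (sub-add a b) ⟩
      a + q               ∎

    -- If t l = w + u d then t (l × d) = w × d and u (l × d) = w × l.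
    solve-t : ∀ {l₁ l₂ d₁ d₂ w₁ w₂ t u} → t * l₁ ≈ w₁ + u * d₁ → t * l₂ ≈ w₂ + u * d₂ →
              t * cross (l₁ , l₂) (d₁ , d₂) ≈ cross (w₁ , w₂) (d₁ , d₂)
    solve-t {l₁} {l₂} {d₁} {d₂} {w₁} {w₂} {t} {u} eq₁ eq₂ = +-cancelʳ (t * l₂ * d₁) _ _ (begin
      t * Δ + t * l₂ * d₁              ≈⟨ solve 4 (λ t Δ l d → t :* Δ :+ t :* l :* d := t :* (Δ :+ l :* d)) ≈-refl t Δ l₂ d₁ ⟩
      t * (Δ + l₂ * d₁)                ≈⟨ *-congˡ (sub-add _ _) ⟩
      t * (l₁ * d₂)                    ≈⟨ *-assoc _ _ _ ⟨
      t * l₁ * d₂                      ≈⟨ *-congʳ eq₁ ⟩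
      (w₁ + u * d₁) * d₂               ≈⟨ solve 4 (λ w u d e → (w :+ u :* d) :* e := w :* e :+ u :* d :* e) ≈-refl w₁ u d₁ d₂ ⟩
      w₁ * d₂ + u * d₁ * d₂            ≈⟨ +-congʳ (sub-add _ _) ⟨
      (N + w₂ * d₁) + u * d₁ * d₂      ≈⟨ solve 5 (λ N w d u e → (N :+ w :* d) :+ u :* d :* e := N :+ (w :+ u :* e) :* d) ≈-refl N w₂ d₁ u d₂ ⟩
      N + (w₂ + u * d₂) * d₁           ≈⟨ +-congˡ (*-congʳ eq₂) ⟨
      N + t * l₂ * d₁                  ∎)
      where
      Δ = cross (l₁ , l₂) (d₁ , d₂)
      N = cross (w₁ , w₂) (d₁ , d₂)

    solve-u : ∀ {l₁ l₂ d₁ d₂ w₁ w₂ t u} → t * l₁ ≈ w₁ + u * d₁ → t * l₂ ≈ w₂ + u * d₂ →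
              u * cross (l₁ , l₂) (d₁ , d₂) ≈ cross (w₁ , w₂) (l₁ , l₂)
    solve-u {l₁} {l₂} {d₁} {d₂} {w₁} {w₂} {t} {u} eq₁ eq₂ =
      +-cancelʳ (u * d₁ * l₂ + w₂ * l₁) _ _ (begin
      u * Δ + (u * d₁ * l₂ + w₂ * l₁)  ≈⟨ solve 6 (λ u Δ d l w k → u :* Δ :+ (u :* d :* l :+ w :* k) := u :* (Δ :+ l :* d) :+ w :* k) ≈-refl u Δ d₁ l₂ w₂ l₁ ⟩
      u * (Δ + l₂ * d₁) + w₂ * l₁      ≈⟨ +-congʳ (*-congˡ (sub-add _ _)) ⟩
      u * (l₁ * d₂) + w₂ * l₁          ≈⟨ solve 4 (λ u l d w → u :* (l :* d) :+ w :* l := (w :+ u :* d) :* l) ≈-refl u l₁ d₂ w₂ ⟩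
      (w₂ + u * d₂) * l₁               ≈⟨ *-congʳ eq₂ ⟨
      t * l₂ * l₁                      ≈⟨ solve 3 (λ t l k → t :* l :* k := t :* k :* l) ≈-refl t l₂ l₁ ⟩
      t * l₁ * l₂                      ≈⟨ *-congʳ eq₁ ⟩
      (w₁ + u * d₁) * l₂               ≈⟨ solve 4 (λ w u d l → (w :+ u :* d) :* l := w :* l :+ u :* d :* l) ≈-refl w₁ u d₁ l₂ ⟩
      w₁ * l₂ + u * d₁ * l₂            ≈⟨ +-congʳ (sub-add _ _) ⟨
      (M + w₂ * l₁) + u * d₁ * l₂      ≈⟨ solve 3 (λ a b c → (a :+ b) :+ c := a :+ (c :+ b)) ≈-refl M (w₂ * l₁) (u * d₁ * l₂) ⟩
      M + (u * d₁ * l₂ + w₂ * l₁)      ∎)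
      where
      Δ = cross (l₁ , l₂) (d₁ , d₂)
      M = cross (w₁ , w₂) (l₁ , l₂)

    -- (w × d) l = (l × d) w + (w × l) d.
    expand : ∀ l₁ l₂ d₁ d₂ w₁ w₂ → let l = l₁ , l₂ ; d = d₁ , d₂ ; w = w₁ , w₂ in
             (cross w d · l) ≈ₚ (cross l d · w +ₚ cross w l · d)
    expand l₁ l₂ d₁ d₂ w₁ w₂ =
        +-cancelʳ (l₂ * d₁ * w₁ + w₂ * l₁ * d₁) _ _ (begin
          N * l₁ + (l₂ * d₁ * w₁ + w₂ * l₁ * d₁)
            ≈⟨ solve 6 (λ N k d w v l → N :* k :+ (l :* d :* w :+ v :* k :* d) := (N :+ v :* d) :* k :+ l :* d :* w) ≈-refl N l₁ d₁ w₁ w₂ l₂ ⟩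
          (N + w₂ * d₁) * l₁ + l₂ * d₁ * w₁
            ≈⟨ +-congʳ (*-congʳ (sub-add _ _)) ⟩
          w₁ * d₂ * l₁ + l₂ * d₁ * w₁
            ≈⟨ solve 5 (λ w e k l d → w :* e :* k :+ l :* d :* w := k :* e :* w :+ w :* l :* d) ≈-refl w₁ d₂ l₁ l₂ d₁ ⟩
          l₁ * d₂ * w₁ + w₁ * l₂ * d₁
            ≈⟨ +-cong (*-congʳ (sub-add _ _)) (*-congʳ (sub-add _ _)) ⟨
          (Δ + l₂ * d₁) * w₁ + (M + w₂ * l₁) * d₁
            ≈⟨ solve 7 (λ Δ l d w M v k → (Δ :+ l :* d) :* w :+ (M :+ v :* k) :* d := (Δ :* w :+ M :* d) :+ (l :* d :* w :+ v :* k :* d)) ≈-refl Δ l₂ d₁ w₁ M w₂ l₁ ⟩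
          (Δ * w₁ + M * d₁) + (l₂ * d₁ * w₁ + w₂ * l₁ * d₁) ∎)
      , +-cancelʳ (l₂ * d₁ * w₂ + w₂ * l₁ * d₂) _ _ (begin
          N * l₂ + (l₂ * d₁ * w₂ + w₂ * l₁ * d₂)
            ≈⟨ solve 6 (λ N l d v k e → N :* l :+ (l :* d :* v :+ v :* k :* e) := (N :+ v :* d) :* l :+ v :* k :* e) ≈-refl N l₂ d₁ w₂ l₁ d₂ ⟩
          (N + w₂ * d₁) * l₂ + w₂ * l₁ * d₂
            ≈⟨ +-congʳ (*-congʳ (sub-add _ _)) ⟩
          w₁ * d₂ * l₂ + w₂ * l₁ * d₂
            ≈⟨ solve 5 (λ w e l v k → w :* e :* l :+ v :* k :* e := k :* e :* v :+ w :* l :* e) ≈-refl w₁ d₂ l₂ w₂ l₁ ⟩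
          l₁ * d₂ * w₂ + w₁ * l₂ * d₂
            ≈⟨ +-cong (*-congʳ (sub-add _ _)) (*-congʳ (sub-add _ _)) ⟨
          (Δ + l₂ * d₁) * w₂ + (M + w₂ * l₁) * d₂
            ≈⟨ solve 7 (λ Δ l d v M k e → (Δ :+ l :* d) :* v :+ (M :+ v :* k) :* e := (Δ :* v :+ M :* e) :+ (l :* d :* v :+ v :* k :* e)) ≈-refl Δ l₂ d₁ w₂ M l₁ d₂ ⟩
          (Δ * w₂ + M * d₂) + (l₂ * d₁ * w₂ + w₂ * l₁ * d₂) ∎)
      where
      Δ = cross (l₁ , l₂) (d₁ , d₂)
      M = cross (w₁ , w₂) (l₁ , l₂)
      N = cross (w₁ , w₂) (d₁ , d₂)

    divide : ∀ {x y Δ Δ⁻¹} → Δ * Δ⁻¹ ≈ 1# → x * Δ ≈ y → x ≈ y * Δ⁻¹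
    divide {x} {y} {Δ} {Δ⁻¹} inv eq = begin
      x               ≈⟨ *-identityʳ x ⟨
      x * 1#          ≈⟨ *-congˡ inv ⟨
      x * (Δ * Δ⁻¹)   ≈⟨ *-assoc _ _ _ ⟨
      x * Δ * Δ⁻¹     ≈⟨ *-congʳ eq ⟩
      y * Δ⁻¹         ∎

    scale : ∀ {N l Δ w M d Δ⁻¹} → Δ * Δ⁻¹ ≈ 1# → N * l ≈ Δ * w + M * d →
            (N * Δ⁻¹) * l ≈ w + (M * Δ⁻¹) * d
    scale {N} {l} {Δ} {w} {M} {d} {Δ⁻¹} inv eq = begin
      N * Δ⁻¹ * l                   ≈⟨ solve 3 (λ a b c → a :* b :* c := a :* c :* b) ≈-refl N Δ⁻¹ l ⟩
      N * l * Δ⁻¹                   ≈⟨ *-congʳ eq ⟩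
      (Δ * w + M * d) * Δ⁻¹         ≈⟨ solve 5 (λ a b c d e → (a :* b :+ c :* d) :* e := (a :* e) :* b :+ (c :* e) :* d) ≈-refl Δ w M d Δ⁻¹ ⟩
      (Δ * Δ⁻¹) * w + M * Δ⁻¹ * d   ≈⟨ +-congʳ (*-congʳ inv) ⟩
      1# * w + M * Δ⁻¹ * d          ≈⟨ +-congʳ (*-identityˡ w) ⟩
      w + M * Δ⁻¹ * d               ∎

    _≤?_ : ∀ x y → Dec (x ≤ y)
    x ≤? y = (x <? y) ⊎-dec (x ≟ y)

    ≤-resp : ∀ {x x′ y y′} → x ≈ x′ → y ≈ y′ → x ≤ y → x′ ≤ y′
    ≤-resp p q (inj₁ x<y) = inj₁ (<-respˡ-≈ p (<-respʳ-≈ q x<y))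
    ≤-resp p q (inj₂ x≈y) = inj₂ (≈-trans (≈-sym p) (≈-trans x≈y q))

  rayMeets? : ∀ b l a d → ¬ (cross l d ≈ 0#) → Dec (RayMeets b l a d)
  rayMeets? b@(b₁ , b₂) l@(l₁ , l₂) a@(a₁ , a₂) d@(d₁ , d₂) l∦d
    with invertible (cross l d) l∦d
  ... | Δ⁻¹ , inv = map′ to from ((0# <? t) ×-dec (0# ≤? u) ×-dec (u ≤? 1#))
    where
    w = a -ₚ b
    t = cross w d * Δ⁻¹
    u = cross w l * Δ⁻¹

    to : 0# < t × InUnitInterval u → RayMeets b l a d
    to (0<t , 0≤u≤1) = t , u , 0<t , 0≤u≤1 ,
      unmove (scale inv (proj₁ (expand l₁ l₂ d₁ d₂ (a₁ - b₁) (a₂ - b₂)))) ,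
      unmove (scale inv (proj₂ (expand l₁ l₂ d₁ d₂ (a₁ - b₁) (a₂ - b₂))))

    from : RayMeets b l a d → 0# < t × InUnitInterval u
    from (t′ , u′ , 0<t′ , (0≤u′ , u′≤1) , eq₁ , eq₂) =
      <-respʳ-≈ t′≈t 0<t′ , ≤-resp ≈-refl u′≈u 0≤u′ , ≤-resp u′≈u ≈-refl u′≤1
      where
      t′≈t : t′ ≈ t
      t′≈t = divide inv (solve-t (move eq₁) (move eq₂))
      u′≈u : u′ ≈ u
      u′≈u = divide inv (solve-u (move eq₁) (move eq₂))

  ∑ : ∀ {A : Set} → List A → (A → Carrier) → Carrier
  ∑ xs f = foldr (λ x acc → f x + acc) 0# xs

  sign : Parity → Carrier
  sign 0ℙ = 1#
  sign 1ℙ = - 1#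

  -1^_ : ℤ → Carrier
  -1^ z = sign (parityℤ z)

  ℝ^ : ℕ → Set
  ℝ^ n = Fin n → Carrier

  infix 4 _≈ᵛ_
  _≈ᵛ_ : ∀ {n} → ℝ^ n → ℝ^ n → Set
  x ≈ᵛ y = ∀ i → x i ≈ y i

  0ᵛ : ∀ {n} → ℝ^ n
  0ᵛ _ = 0#

  basis : ∀ {n} → Fin n → ℝ^ n
  basis j i = if does (i Fin.≟ j) then 1# else 0#

  combination : ∀ {n} → Subset n → (Fin n → Carrier) → ℝ^ n
  combination J a i = ∑ (filter (_∈? J) (allFin _)) λ j → a j * basis j i

  module EdgeVectors {n} (N : PlabicNetwork n) (ray : GaugeRayDirection N) where
    open PlabicNetwork N
    open GaugeRayDirection ray

    wind : Edge → Edge → ℤ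
    wind e f =
      if does ((s a b ℤ.≟ s a 𝔩) ×-dec (s a 𝔩 ℤ.≟ s 𝔩 b)) then s a b else 0ℤ
      where
      a = direction e
      b = direction f

    -- A gauge ray, not being parallel to e, meets it at most once, so int e
    -- counts the gauge rays that meet e away from their base point.
    int : Edge → ℕ
    int e = length (filter
      (λ i → rayMeets? (pos (boundary i)) 𝔩 (pos (src e)) (direction e) (not-parallel e))
      (filter (_∈? sources) (allFin n)))

    windₚ : ∀ {e v} → Path graph e v → ℤ
    windₚ     [ _ ]             = 0ℤ
    windₚ {e} (_∷_ {f = f} _ P) = wind e f ℤ.+ windₚ P

    intₚ : ∀ {e v} → Path graph e v → ℕ
    intₚ {e} [ _ ]   = int e
    intₚ {e} (_ ∷ P) = int e ℕ.+ intₚ P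

    weightₚ : ∀ {e v} → Path graph e v → Carrier
    weightₚ {e} [ _ ]   = weight e
    weightₚ {e} (_ ∷ P) = weight e * weightₚ P

    exponent : ∀ {e v} → Path graph e v → ℤ
    exponent P = windₚ P ℤ.+ ℤ.+ intₚ P

    edgeVector : Edge → ℝ^ n
    edgeVector e j =
      ∑ (paths e (boundary j)) λ P → (-1^ exponent P) * weightₚ P

    -- In an acyclic network the edge flows from e to b_j are the directed
    -- paths from e to b_j.
    flows : ∀ e j → List (Path graph e (boundary j))
    flows e j = paths e (boundary j)

    EdgeVectorsNonNull : Set
    EdgeVectorsNonNull = ∀ e → ¬ (edgeVector e ≈ᵛ 0ᵛ)

    EdgeVectorFormula : Set
    EdgeVectorFormula =
      ∃ λ (σ : Edge → Fin n → Parity) →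
        (∀ e j → j ∈ ∁ sources → (F : Path graph e (boundary j)) →
           parityℤ (exponent F) ≡ σ e j)
      × (∀ e → edgeVector e ≈ᵛ combination (∁ sources) λ j →
           ∑ (flows e j) λ F → (-1^ exponent F) * weightₚ F)
      × (∀ e → edgeVector e ≈ᵛ combination (∁ sources) λ j →
           sign (σ e j) * ∑ (flows e j) weightₚ)

  -- A network is a Le-network if its directed graph is that of a
  -- Le-diagram, with the same boundary labels and the same cyclic order of
  -- the edges at each vertex (which fixes the drawing up to isotopy).
  -- Parallel edges do not occur, so it suffices to match the vertices.
  record IsLeNetwork {n} (N : PlabicNetwork n) : Set where
    open PlabicNetwork N
    field
      {k m}      : ℕ
      k+m≡n      : k ℕ.+ m ≡ n
      leDiagram  : LeDiagram k m

    open LeDiagram leDiagram using (rowLabel; columnLabel)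

    field
      place           : LeVertex leDiagram → Vertex
      place-bijective : Bijective _≡_ _≡_ place
      place-source    : ∀ r → ∃ λ j → toℕ j ≡ rowLabel r × place (source r) ≡ boundary j
      place-sink      : ∀ c → ∃ λ j → toℕ j ≡ columnLabel c × place (sink c) ≡ boundary j
      arc⇒edge        : ∀ {κ u v} → LeArc leDiagram κ u v → Adjacent (place u) (place v)
      edge⇒arc        : ∀ e → ∃ λ κ → ∃₂ λ u v → LeArc leDiagram κ u v
                            × place u ≡ src e × place v ≡ tgt e
      cyclic-order    : ∀ {x u v w ρ₁ ρ₂ ρ₃} →
        Dart leDiagram x u ρ₁ → Dart leDiagram x v ρ₂ → Dart leDiagram x w ρ₃ →
        ρ₁ ℕ.< ρ₂ → ρ₂ ℕ.< ρ₃ →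
        Counterclockwise (pos (place u) -ₚ pos (place x))
                         (pos (place v) -ₚ pos (place x))
                         (pos (place w) -ₚ pos (place x))

{-# OPTIONS --safe #-}
-- The sign of a path is constant because of a discrete Umlaufsatz.  Let χ d d′
-- be the parity of the crossings of the segment from d to d′ with the ray from
-- the origin in the gauge direction 𝔩.  For the closed path of differences of
-- the points of two disjoint segments the sum of χ vanishes, and χ of two
-- consecutive edge directions is their winding mod 2.  Hence the winding of a
-- path P, which is simple by acyclicity, has the parity of the number of
-- meetings of P with the ray from its first vertex, plus those of P with the
-- ray opposite to 𝔩 from its last vertex; the latter is empty at a boundary
-- vertex.  If the first vertex is on the boundary, an edge meets its ray
-- precisely when its ends lie on different sides of the ray, so both this
-- number and the intersections with the gauge rays telescope to a quantity that
-- depends only on the first edge and the last vertex.  Any edge is reached from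
-- a boundary source, and prepending a path changes all windings by the same
-- amount.  So no cancellation occurs, and some path leads to a boundary sink.
module Submission where

open import Defs
open import Level using (0ℓ)
open import Algebra.Bundles using (CommutativeRing; RawRing)
import Algebra.Properties.Ring as RingProperties
import Algebra.Properties.Semiring.Mult.TCOptimised as Mult
import Algebra.Solver.Ring as RingSolver
open import Algebra.Solver.Ring.AlmostCommutativeRing
  using (_-Raw-AlmostCommutative⟶_; fromCommutativeRing)
open import Data.Bool.Base using (if_then_else_)
open import Data.Fin.Base using (Fin; toℕ)
import Data.Fin.Properties as Fin
open import Data.Fin.Induction using (spo-wellFounded; spo-noetherian)
open import Data.Fin.Subset using (∁; _∈_; _∉_)
open import Data.Fin.Subset.Properties using (_∈?_; x∉∁p⇒x∈p)
open import Data.List.Base using (List; []; _∷_; length; filter; allFin)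
import Data.List.Membership.Propositional as List
import Data.List.Membership.Propositional.Properties as List
import Data.List.Relation.Unary.All as All
open import Data.List.Relation.Unary.AllPairs using (_∷_)
open import Data.List.Relation.Unary.Any using (here; there)
open import Data.List.Relation.Unary.Unique.Propositional using (Unique)
import Data.List.Relation.Unary.Unique.Propositional.Properties as Unique
open import Data.Integer.Base as ℤ using (ℤ; -[1+_])
import Data.Integer.Properties as ℤ
open import Data.Maybe.Base as Maybe using (Maybe)
open import Data.Nat.Base as ℕ using (ℕ; zero; suc)
import Data.Nat.Properties as ℕ
open import Data.Parity.Base using (Parity; 0ℙ; 1ℙ) renaming (_+_ to infixl 6 _ℙ+_)
import Data.Parity.Properties as Parity
open import Algebra.Properties.CommutativeSemigroup Parity.+-commutativeSemigroup
  using (xy∙z≈zy∙x; interchange)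
open import Data.Product.Base using (_×_; _,_; proj₁; proj₂; ∃)
open import Data.Sign.Base as Sign using (Sign)
open import Data.Sum.Base using (_⊎_; inj₁; inj₂)
open import Data.Vec.Properties using ([]=⇒lookup; lookup∘tabulate)
open import Function.Base using (flip)
open import Induction.WellFounded using (WellFounded; Acc; acc)
open import Relation.Binary.Consequences using (dec⇒weaklyDec)
open import Relation.Binary.PropositionalEquality as ≡ using (_≡_; _≢_)
open import Relation.Binary.Structures using (IsStrictPartialOrder; IsStrictTotalOrder)
open import Relation.Nullary.Decidable using (Dec; yes; no; does; _×-dec_)
open import Relation.Nullary.Negation using (¬_; contradiction)

-- Ring solver with integer coefficients.

-- The canonical homomorphism from ℤ provides the ring solver with decidable
-- coefficients.
module IntegerCoefficients (R : CommutativeRing 0ℓ 0ℓ) where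
  open CommutativeRing R
  open RingProperties ring
  open Mult semiring using (1+×; ×-homo-+; ×1-homo-*) renaming (_×_ to _⊠_)
  open import Relation.Binary.Reasoning.Setoid setoid

  private
    -- The optimised multiple makes `1 ⊠ 1#` compute to `1#`, so the solver constants 0 and 1 denote
    -- `0#` and `1#` definitionally.
    ι : ℤ → Carrier
    ι (ℤ.+ n)  = n ⊠ 1#
    ι -[1+ n ] = - (suc n ⊠ 1#)

    cancel-+ : ∀ x y z → (x + y) - (x + z) ≈ y - z
    cancel-+ x y z = begin
      (x + y) - (x + z)       ≈⟨ +-cong (+-comm x y) (sym (-‿+-comm x z)) ⟩
      (y + x) + (- x - z)     ≈⟨ +-assoc y x _ ⟩
      y + (x + (- x - z))     ≈⟨ +-congˡ (sym (+-assoc x (- x) (- z))) ⟩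
      y + ((x - x) - z)       ≈⟨ +-congˡ (+-congʳ (-‿inverseʳ x)) ⟩
      y + (0# - z)            ≈⟨ +-congˡ (+-identityˡ (- z)) ⟩
      y - z                   ∎

    ι-⊖ : ∀ m n → ι (m ℤ.⊖ n) ≈ m ⊠ 1# - n ⊠ 1#
    ι-⊖ m zero = begin
      m ⊠ 1#         ≈⟨ sym (+-identityʳ _) ⟩
      m ⊠ 1# + 0#    ≈⟨ +-congˡ (sym -0#≈0#) ⟩
      m ⊠ 1# - 0#    ∎
    ι-⊖ zero (suc n) = sym (+-identityˡ _)
    ι-⊖ (suc m) (suc n) = begin
      ι (suc m ℤ.⊖ suc n)                 ≡⟨ ≡.cong ι (ℤ.[1+m]⊖[1+n]≡m⊖n m n) ⟩
      ι (m ℤ.⊖ n)                         ≈⟨ ι-⊖ m n ⟩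
      m ⊠ 1# - n ⊠ 1#                     ≈⟨ sym (cancel-+ 1# _ _) ⟩
      (1# + m ⊠ 1#) - (1# + n ⊠ 1#)       ≈⟨ sym (+-cong (1+× m 1#) (-‿cong (1+× n 1#))) ⟩
      suc m ⊠ 1# - suc n ⊠ 1#             ∎

    ι-+ : ∀ i j → ι (i ℤ.+ j) ≈ ι i + ι j
    ι-+ (ℤ.+ m)  (ℤ.+ n)  = ×-homo-+ 1# m n
    ι-+ (ℤ.+ m)  -[1+ n ] = ι-⊖ m (suc n)
    ι-+ -[1+ m ] (ℤ.+ n)  = trans (ι-⊖ n (suc m)) (+-comm _ _)
    ι-+ -[1+ m ] -[1+ n ] = begin
      - (suc (suc (m ℕ.+ n)) ⊠ 1#)        ≡⟨ ≡.cong (λ k → - (suc k ⊠ 1#)) (ℕ.+-suc m n) ⟨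
      - ((suc m ℕ.+ suc n) ⊠ 1#)          ≈⟨ -‿cong (×-homo-+ 1# (suc m) (suc n)) ⟩
      - (suc m ⊠ 1# + suc n ⊠ 1#)         ≈⟨ sym (-‿+-comm _ _) ⟩
      - (suc m ⊠ 1#) - suc n ⊠ 1#         ∎

    ι-neg : ∀ i → ι (ℤ.- i) ≈ - ι i
    ι-neg (ℤ.+ zero)  = sym -0#≈0#
    ι-neg (ℤ.+ suc n) = refl
    ι-neg -[1+ n ]    = sym (-‿involutive _)

    -- Products of opposite signs are formed with `Sign.- ℤ.◃_`, which sends 0 to `ℤ.+ 0`; hence the
    -- case distinction.
    ι-- : ∀ n → ι (Sign.- ℤ.◃ n) ≈ - (n ⊠ 1#)
    ι-- zero    = sym -0#≈0#
    ι-- (suc n) = refl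

    ι-* : ∀ i j → ι (i ℤ.* j) ≈ ι i * ι j
    ι-* (ℤ.+ m)  (ℤ.+ n)  = trans (reflexive (≡.cong ι (ℤ.+◃n≡+n (m ℕ.* n)))) (×1-homo-* m n)
    ι-* (ℤ.+ m)  -[1+ n ] = begin
      ι (Sign.- ℤ.◃ (m ℕ.* suc n))        ≈⟨ ι-- (m ℕ.* suc n) ⟩
      - ((m ℕ.* suc n) ⊠ 1#)              ≈⟨ -‿cong (×1-homo-* m (suc n)) ⟩
      - (m ⊠ 1# * suc n ⊠ 1#)             ≈⟨ -‿distribʳ-* _ _ ⟩
      m ⊠ 1# * - (suc n ⊠ 1#)             ∎
    ι-* -[1+ m ] (ℤ.+ n)  = begin
      ι (Sign.- ℤ.◃ (suc m ℕ.* n))        ≈⟨ ι-- (suc m ℕ.* n) ⟩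
      - ((suc m ℕ.* n) ⊠ 1#)              ≈⟨ -‿cong (×1-homo-* (suc m) n) ⟩
      - (suc m ⊠ 1# * n ⊠ 1#)             ≈⟨ -‿distribˡ-* _ _ ⟩
      - (suc m ⊠ 1#) * n ⊠ 1#             ∎
    ι-* -[1+ m ] -[1+ n ] = begin
      (suc m ℕ.* suc n) ⊠ 1#              ≈⟨ ×1-homo-* (suc m) (suc n) ⟩
      suc m ⊠ 1# * suc n ⊠ 1#             ≈⟨ sym (-‿involutive _) ⟩
      - - (suc m ⊠ 1# * suc n ⊠ 1#)       ≈⟨ -‿cong (-‿distribʳ-* _ _) ⟩
      - (suc m ⊠ 1# * - (suc n ⊠ 1#))     ≈⟨ -‿distribˡ-* _ _ ⟩
      - (suc m ⊠ 1#) * - (suc n ⊠ 1#)     ∎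

    integers : RawRing 0ℓ 0ℓ
    integers = record
      { Carrier = ℤ ; _≈_ = _≡_ ; _+_ = ℤ._+_ ; _*_ = ℤ._*_ ; -_ = ℤ.-_
      ; 0# = ℤ.0ℤ ; 1# = ℤ.1ℤ }

    morphism : integers -Raw-AlmostCommutative⟶ fromCommutativeRing R
    morphism = record
      { ⟦_⟧ = ι ; +-homo = ι-+ ; *-homo = ι-* ; -‿homo = ι-neg
      ; 0-homo = refl ; 1-homo = refl }

    _coeff≟_ : ∀ i j → Maybe (ι i ≈ ι j)
    i coeff≟ j = Maybe.map (λ { ≡.refl → refl }) (dec⇒weaklyDec ℤ._≟_ i j)

  open RingSolver integers (fromCommutativeRing R) morphism _coeff≟_ public
    using (solve; _:=_; _:+_; _:*_; _:-_; :-_; con; Polynomial)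

-- Indicators of decidable propositions modulo 2.

indicator : ∀ {A : Set} → Dec A → Parity
indicator (yes _) = 1ℙ
indicator (no  _) = 0ℙ

indicator-cong : ∀ {A B : Set} (a? : Dec A) (b? : Dec B) → (A → B) → (B → A) →
                 indicator a? ≡ indicator b?
indicator-cong (yes _) (yes _)  _ _ = ≡.refl
indicator-cong (yes a) (no ¬b)  f _ = contradiction (f a) ¬b
indicator-cong (no ¬a) (yes b)  _ g = contradiction (g b) ¬a
indicator-cong (no _)  (no _)   _ _ = ≡.refl

indicator-no : ∀ {A : Set} (a? : Dec A) → ¬ A → indicator a? ≡ 0ℙ
indicator-no (yes a) ¬a = contradiction a ¬a
indicator-no (no _)  _  = ≡.refl

indicator-yes : ∀ {A : Set} (a? : Dec A) → A → indicator a? ≡ 1ℙ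
indicator-yes (yes _) _ = ≡.refl
indicator-yes (no ¬a) a = contradiction a ¬a

≡⇒+≡0 : ∀ {p q} → p ≡ q → p ℙ+ q ≡ 0ℙ
≡⇒+≡0 {p} ≡.refl = Parity.p+p≡0ℙ p

+≡0⇒≡ : ∀ p q → p ℙ+ q ≡ 0ℙ → p ≡ q
+≡0⇒≡ 0ℙ 0ℙ _ = ≡.refl
+≡0⇒≡ 1ℙ 1ℙ _ = ≡.refl

module Planar (ℝ : RealField) where
  open RealField ℝ
  open RingProperties ring using (-‿involutive; -0#≈0#; -‿+-comm)
  open IntegerCoefficients commutativeRing
  open Networks ℝ using (Point; _≈ₚ_; _+ₚ_; _-ₚ_; _·_; cross; s; InUnitInterval; RayMeets)
  open IsStrictTotalOrder isStrictTotalOrder using () renaming (trans to <-trans; irrefl to <-irrefl)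
  open import Relation.Binary.Definitions using (tri<; tri≈; tri>)
  open import Relation.Binary.Reasoning.Setoid setoid

  -- Sign rules in an ordered field.

  pos⇒≉0 : ∀ {x} → 0# < x → ¬ (x ≈ 0#)
  pos⇒≉0 0<x x≈0 = <-irrefl (sym x≈0) 0<x

  neg⇒≉0 : ∀ {x} → x < 0# → ¬ (x ≈ 0#)
  neg⇒≉0 x<0 x≈0 = <-irrefl x≈0 x<0

  nonneg-resp : ∀ {x y} → x ≈ y → 0# ≤ x → 0# ≤ y
  nonneg-resp x≈y (inj₁ 0<x) = inj₁ (<-respʳ-≈ x≈y 0<x)
  nonneg-resp x≈y (inj₂ 0≈x) = inj₂ (trans 0≈x x≈y)

  nonneg? : ∀ x → x < 0# ⊎ 0# ≤ x
  nonneg? x with compare x 0#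
  ... | tri< x<0 _ _ = inj₁ x<0
  ... | tri≈ _ x≈0 _ = inj₂ (inj₂ (sym x≈0))
  ... | tri> _ _ 0<x = inj₂ (inj₁ 0<x)

  ≮0⇒nonneg : ∀ {x} → ¬ (x < 0#) → 0# ≤ x
  ≮0⇒nonneg {x} x≮0 with nonneg? x
  ... | inj₁ x<0 = contradiction x<0 x≮0
  ... | inj₂ 0≤x = 0≤x

  nonneg⇒≮0 : ∀ {x} → 0# ≤ x → ¬ (x < 0#)
  nonneg⇒≮0 (inj₁ 0<x) x<0 = <-irrefl refl (<-trans 0<x x<0)
  nonneg⇒≮0 (inj₂ 0≈x) x<0 = neg⇒≉0 x<0 (sym 0≈x)

  pos+nonneg : ∀ {x y} → 0# < x → 0# ≤ y → 0# < x + y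
  pos+nonneg {x} {y} 0<x (inj₁ 0<y) =
    <-trans 0<x (<-respˡ-≈ (+-identityʳ x) (+-monoʳ-< x 0<y))
  pos+nonneg {x} {y} 0<x (inj₂ 0≈y) =
    <-respʳ-≈ (trans (sym (+-identityʳ x)) (+-congˡ 0≈y)) 0<x

  nonneg+pos : ∀ {x y} → 0# ≤ x → 0# < y → 0# < x + y
  nonneg+pos 0≤x 0<y = <-respʳ-≈ (+-comm _ _) (pos+nonneg 0<y 0≤x)

  nonneg+nonneg : ∀ {x y} → 0# ≤ x → 0# ≤ y → 0# ≤ x + y
  nonneg+nonneg (inj₁ 0<x) 0≤y = inj₁ (pos+nonneg 0<x 0≤y)
  nonneg+nonneg (inj₂ 0≈x) 0≤y =
    nonneg-resp (trans (sym (+-identityˡ _)) (+-congʳ 0≈x)) 0≤y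

  nonneg*nonneg : ∀ {x y} → 0# ≤ x → 0# ≤ y → 0# ≤ x * y
  nonneg*nonneg (inj₁ 0<x) (inj₁ 0<y) = inj₁ (*-pos 0<x 0<y)
  nonneg*nonneg {x} {y} (inj₂ 0≈x) _ = inj₂ (trans (sym (zeroˡ y)) (*-congʳ 0≈x))
  nonneg*nonneg {x} {y} _ (inj₂ 0≈y) = inj₂ (trans (sym (zeroʳ x)) (*-congˡ 0≈y))

  neg⇒-pos : ∀ {x} → x < 0# → 0# < - x
  neg⇒-pos {x} x<0 =
    <-respˡ-≈ (-‿inverseˡ x) (<-respʳ-≈ (+-identityʳ (- x)) (+-monoʳ-< (- x) x<0))

  pos⇒-neg : ∀ {x} → 0# < x → - x < 0#
  pos⇒-neg {x} 0<x =
    <-respˡ-≈ (+-identityʳ (- x)) (<-respʳ-≈ (-‿inverseˡ x) (+-monoʳ-< (- x) 0<x))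

  ≯0⇒-nonneg : ∀ {x} → ¬ (0# < x) → 0# ≤ - x
  ≯0⇒-nonneg {x} x≯0 = ≮0⇒nonneg λ -x<0 →
    x≯0 (<-respʳ-≈ (-‿involutive x) (neg⇒-pos -x<0))

  x+y≈1⇒y≤1 : ∀ {x y} → x + y ≈ 1# → 0# ≤ x → y ≤ 1#
  x+y≈1⇒y≤1 {x} {y} eq (inj₁ 0<x) = inj₁ (<-respʳ-≈ (trans (+-comm y x) eq)
    (<-respˡ-≈ (+-identityʳ y) (+-monoʳ-< y 0<x)))
  x+y≈1⇒y≤1 {x} {y} eq (inj₂ 0≈x) = inj₂ (begin
    y       ≈⟨ sym (+-identityˡ y) ⟩
    0# + y  ≈⟨ +-congʳ 0≈x ⟩
    x + y   ≈⟨ eq ⟩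
    1#      ∎)

  y≤1⇒0≤1-y : ∀ {y} → y ≤ 1# → 0# ≤ 1# - y
  y≤1⇒0≤1-y {y} (inj₁ y<1) = inj₁ (<-respˡ-≈ (-‿inverseˡ y)
    (<-respʳ-≈ (+-comm (- y) 1#) (+-monoʳ-< (- y) y<1)))
  y≤1⇒0≤1-y {y} (inj₂ y≈1) = inj₂ (trans (sym (-‿inverseʳ y)) (+-congʳ y≈1))

  inverse-pos : ∀ {x y} → x * y ≈ 1# → 0# < x → 0# < y
  inverse-pos {x} {y} xy≈1 0<x with compare y 0#
  ... | tri> _ _ 0<y = 0<y
  ... | tri≈ _ y≈0 _ = contradiction
    (trans (sym xy≈1) (trans (*-congˡ y≈0) (zeroʳ x))) (pos⇒≉0 0<1)
  ... | tri< y<0 _ _ = contradiction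
    (solve 2 (λ x y → x :* (:- y) :+ x :* y := con ℤ.0ℤ) refl x y)
    (pos⇒≉0 (pos+nonneg (*-pos 0<x (neg⇒-pos y<0)) (inj₁ (<-respʳ-≈ (sym xy≈1) 0<1))))

  -- Determinants and triangles that avoid the origin.

  det : ∀ {n} (a b c d : Polynomial n) → Polynomial n
  det a b c d = a :* d :- b :* c

  0ₚ : Point
  0ₚ = 0# , 0#

  -- The origin is not in the convex hull of the three points.
  Avoids : Point → Point → Point → Set
  Avoids d₀ d₁ d₂ = ∀ a b c → 0# ≤ a → 0# ≤ b → 0# ≤ c → (a + b) + c ≈ 1# →
                    ¬ ((a · d₀ +ₚ b · d₁) +ₚ c · d₂ ≈ₚ 0ₚ)

  avoids-rotate : ∀ {d₀ d₁ d₂} → Avoids d₀ d₁ d₂ → Avoids d₁ d₂ d₀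
  avoids-rotate avoids a b c 0≤a 0≤b 0≤c eq (p , q) =
    avoids c a b 0≤c 0≤a 0≤b (trans (rotate c a b) eq)
      (trans (rotate _ _ _) p , trans (rotate _ _ _) q)
    where
    rotate : ∀ x y z → (x + y) + z ≈ (y + z) + x
    rotate = solve 3 (λ x y z → (x :+ y) :+ z := (y :+ z) :+ x) refl

  avoids-swap : ∀ {d₀ d₁ d₂} → Avoids d₀ d₁ d₂ → Avoids d₀ d₂ d₁
  avoids-swap avoids a b c 0≤a 0≤b 0≤c eq (p , q) =
    avoids a c b 0≤a 0≤c 0≤b (trans (swap a c b) eq)
      (trans (swap _ _ _) p , trans (swap _ _ _) q)
    where
    swap : ∀ x y z → (x + y) + z ≈ (x + z) + y
    swap = solve 3 (λ x y z → (x :+ y) :+ z := (x :+ z) :+ y) refl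

  -- The weights supplied by `cramer` need not sum to 1. Dividing by their positive sum keeps both
  -- their signs and the relation.
  avoids-scale : ∀ {d₀ d₁ d₂} → Avoids d₀ d₁ d₂ →
                 ∀ a b c → 0# ≤ a → 0# ≤ b → 0# ≤ c → 0# < (a + b) + c →
                 ¬ ((a · d₀ +ₚ b · d₁) +ₚ c · d₂ ≈ₚ 0ₚ)
  avoids-scale {d₀} {d₁} {d₂} avoids a b c 0≤a 0≤b 0≤c 0<s (p , q)
    with invertible ((a + b) + c) (pos⇒≉0 0<s)
  ... | t , st≈1 = avoids (t * a) (t * b) (t * c)
      (nonneg*nonneg 0≤t 0≤a) (nonneg*nonneg 0≤t 0≤b) (nonneg*nonneg 0≤t 0≤c)
      (trans (solve 4 (λ t a b c → (t :* a :+ t :* b) :+ t :* c := ((a :+ b) :+ c) :* t) refl t a b c) st≈1)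
      (scaled p , scaled q)
    where
    0≤t : 0# ≤ t
    0≤t = inj₁ (inverse-pos st≈1 0<s)
    scaled : ∀ {x y z} → (a * x + b * y) + c * z ≈ 0# →
             (t * a * x + t * b * y) + t * c * z ≈ 0#
    scaled {x} {y} {z} eq = begin
      (t * a * x + t * b * y) + t * c * z
        ≈⟨ solve 7 (λ t a b c x y z → (t :* a :* x :+ t :* b :* y) :+ t :* c :* z
                      := t :* ((a :* x :+ b :* y) :+ c :* z)) refl t a b c x y z ⟩
      t * ((a * x + b * y) + c * z)  ≈⟨ *-congˡ eq ⟩
      t * 0#                         ≈⟨ zeroʳ t ⟩
      0#                             ∎

  -- The linear dependence of three plane vectors, with their minors as coefficients. When the
  -- minors are nonnegative and not all zero it exhibits the origin in the triangle, against
  -- `Avoids`.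
  cramer : ∀ d₀ d₁ d₂ →
           (cross d₁ d₂ · d₀ +ₚ cross d₂ d₀ · d₁) +ₚ cross d₀ d₁ · d₂ ≈ₚ 0ₚ
  cramer (x₀ , y₀) (x₁ , y₁) (x₂ , y₂) =
      solve 6 (λ x₀ y₀ x₁ y₁ x₂ y₂ →
        (det x₁ y₁ x₂ y₂ :* x₀ :+ det x₂ y₂ x₀ y₀ :* x₁) :+ det x₀ y₀ x₁ y₁ :* x₂
        := con ℤ.0ℤ) refl x₀ y₀ x₁ y₁ x₂ y₂
    , solve 6 (λ x₀ y₀ x₁ y₁ x₂ y₂ →
        (det x₁ y₁ x₂ y₂ :* y₀ :+ det x₂ y₂ x₀ y₀ :* y₁) :+ det x₀ y₀ x₁ y₁ :* y₂
        := con ℤ.0ℤ) refl x₀ y₀ x₁ y₁ x₂ y₂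

  -- `cramer` under the linear form `cross l`. It ties the signs of the minors to the sides on which
  -- the vectors lie.
  cramer-cross : ∀ l d₀ d₁ d₂ →
    (cross d₁ d₂ * cross l d₀ + cross d₂ d₀ * cross l d₁) + cross d₀ d₁ * cross l d₂ ≈ 0#
  cramer-cross (p , q) (x₀ , y₀) (x₁ , y₁) (x₂ , y₂) =
    solve 8 (λ p q x₀ y₀ x₁ y₁ x₂ y₂ →
      (det x₁ y₁ x₂ y₂ :* det p q x₀ y₀ :+ det x₂ y₂ x₀ y₀ :* det p q x₁ y₁)
        :+ det x₀ y₀ x₁ y₁ :* det p q x₂ y₂
      := con ℤ.0ℤ) refl p q x₀ y₀ x₁ y₁ x₂ y₂

  cross-anti : ∀ d e → - cross d e ≈ cross e d
  cross-anti (x , y) (x′ , y′) =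
    solve 4 (λ x y x′ y′ → :- det x y x′ y′ := det x′ y′ x y) refl x y x′ y′

  cross-self : ∀ d → cross d d ≈ 0#
  cross-self (x , y) = solve 2 (λ x y → det x y x y := con ℤ.0ℤ) refl x y

  neg*neg : ∀ x y → - x * - y ≈ x * y
  neg*neg = solve 2 (λ x y → :- x :* :- y := x :* y) refl

  -- Crossings of a segment with a ray from the origin.

  module Crossing (l : Point) where

    Left Right : Point → Set
    Right d = cross l d < 0#
    Left  d = 0# ≤ cross l d

    right? : ∀ d → Dec (Right d)
    right? d = cross l d <? 0#

    side : Point → Parity
    side d = indicator (right? d)

    turn : Point → Point → Parity
    turn d e = indicator (0# <? cross d e)

    -- A segment with ends on different sides meets the line of `l`; the turn from its right end to
    -- its left end tells the ray from the opposite one. The decisions are arguments so that case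
    -- distinctions reduce.
    crossing : ∀ {A B : Set} → Dec A → Dec B → Parity → Parity → Parity
    crossing (yes _) (no _)  x _ = x
    crossing (no _)  (yes _) _ y = y
    crossing (yes _) (yes _) _ _ = 0ℙ
    crossing (no _)  (no _)  _ _ = 0ℙ

    -- The parity of the number of times the segment from d to e, which must
    -- avoid the origin, crosses the ray from the origin in direction l; the
    -- points of the line of l count as being to the left.
    χ : Point → Point → Parity
    χ d e = crossing (right? d) (right? e) (turn d e) (turn e d)

    private
      -- Were `cross d₀ d₂` not positive, the signs in `cramer-cross` would force
      -- `0# ≤ cross d₁ d₂`, and `cramer` would place the origin in the triangle. `lonely-left` is
      -- the mirror image.
      lonely-right : ∀ {d₀ d₁ d₂} → Avoids d₀ d₁ d₂ → Right d₀ → Left d₁ → Left d₂ →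
                     0# < cross d₀ d₁ → 0# < cross d₀ d₂
      lonely-right {d₀} {d₁} {d₂} avoids r₀ l₁ l₂ 0<c with 0# <? cross d₀ d₂
      ... | yes 0<  = 0<
      ... | no ≮    = contradiction (cramer d₀ d₁ d₂)
          (avoids-scale avoids _ _ _ 0≤a 0≤b (inj₁ 0<c)
            (nonneg+pos (nonneg+nonneg 0≤a 0≤b) 0<c))
        where
        0≤b : 0# ≤ cross d₂ d₀
        0≤b = nonneg-resp (cross-anti d₀ d₂) (≯0⇒-nonneg ≮)
        0≤a : 0# ≤ cross d₁ d₂
        0≤a = ≮0⇒nonneg λ a<0 → pos⇒≉0
          (pos+nonneg (pos+nonneg (*-pos (neg⇒-pos a<0) (neg⇒-pos r₀))
                                  (nonneg*nonneg 0≤b l₁))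
                      (nonneg*nonneg (inj₁ 0<c) l₂))
          (trans (+-congʳ (+-congʳ (neg*neg _ _))) (cramer-cross l d₀ d₁ d₂))

      lonely-left : ∀ {d₀ d₁ d₂} → Avoids d₀ d₁ d₂ → Left d₀ → Right d₁ → Right d₂ →
                    0# < cross d₁ d₀ → 0# < cross d₂ d₀
      lonely-left {d₀} {d₁} {d₂} avoids l₀ r₁ r₂ 0<c with 0# <? cross d₂ d₀
      ... | yes 0<  = 0<
      ... | no ≮    = contradiction (cramer d₀ d₂ d₁)
          (avoids-scale (avoids-swap avoids) _ _ _ 0≤a (inj₁ 0<c) 0≤b
            (pos+nonneg (nonneg+pos 0≤a 0<c) 0≤b))
        where
        0≤b : 0# ≤ cross d₀ d₂
        0≤b = nonneg-resp (cross-anti d₂ d₀) (≯0⇒-nonneg ≮)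
        0≤a : 0# ≤ cross d₂ d₁
        0≤a = ≮0⇒nonneg λ a<0 → pos⇒≉0
          (pos+nonneg (nonneg+pos (nonneg*nonneg (inj₁ (neg⇒-pos a<0)) l₀)
                                  (*-pos 0<c (neg⇒-pos r₂)))
                      (nonneg*nonneg 0≤b (inj₁ (neg⇒-pos r₁))))
          (begin
            (- cross d₂ d₁ * cross l d₀ + cross d₁ d₀ * - cross l d₂) + cross d₀ d₂ * - cross l d₁
              ≈⟨ solve 6 (λ a x b y c z → (:- a :* x :+ b :* :- y) :+ c :* :- z
                            := :- ((a :* x :+ b :* y) :+ c :* z)) refl
                   (cross d₂ d₁) (cross l d₀) (cross d₁ d₀) (cross l d₂) (cross d₀ d₂) (cross l d₁) ⟩
            - ((cross d₂ d₁ * cross l d₀ + cross d₁ d₀ * cross l d₂) + cross d₀ d₂ * cross l d₁)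
              ≈⟨ -‿cong (cramer-cross l d₀ d₂ d₁) ⟩
            - 0#  ≈⟨ -0#≈0# ⟩
            0#    ∎)

      turn-right : ∀ {d₀ d₁ d₂} → Avoids d₀ d₁ d₂ → Right d₀ → Left d₁ → Left d₂ →
                   turn d₀ d₁ ≡ turn d₀ d₂
      turn-right av r₀ l₁ l₂ = indicator-cong _ _
        (lonely-right av r₀ l₁ l₂) (lonely-right (avoids-swap av) r₀ l₂ l₁)

      turn-left : ∀ {d₀ d₁ d₂} → Avoids d₀ d₁ d₂ → Left d₀ → Right d₁ → Right d₂ →
                  turn d₁ d₀ ≡ turn d₂ d₀
      turn-left av l₀ r₁ r₂ = indicator-cong _ _
        (lonely-left av l₀ r₁ r₂) (lonely-left (avoids-swap av) l₀ r₂ r₁)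

    -- Unless all vertices lie on one side, one is alone on its side. The edge opposite to it
    -- contributes nothing, and the two edges at it cross the ray both or not at all because the
    -- origin is outside the triangle. Rotations bring the lone vertex to the front.
    χ-triangle : ∀ d₀ d₁ d₂ → Avoids d₀ d₁ d₂ →
                 χ d₀ d₁ ℙ+ (χ d₁ d₂ ℙ+ χ d₂ d₀) ≡ 0ℙ
    χ-triangle d₀ d₁ d₂ av = cases (right? d₀) (right? d₁) (right? d₂)
      where
      cases : (p : Dec (Right d₀)) (q : Dec (Right d₁)) (r : Dec (Right d₂)) →
        crossing p q (turn d₀ d₁) (turn d₁ d₀) ℙ+
          (crossing q r (turn d₁ d₂) (turn d₂ d₁) ℙ+
           crossing r p (turn d₂ d₀) (turn d₀ d₂)) ≡ 0ℙ
      cases (yes _) (yes _) (yes _) = ≡.refl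
      cases (no _)  (no _)  (no _)  = ≡.refl
      cases (yes p) (no q)  (no r)  =
        ≡⇒+≡0 (turn-right av p (≮0⇒nonneg q) (≮0⇒nonneg r))
      cases (no p)  (yes q) (yes r) =
        ≡⇒+≡0 (turn-left av (≮0⇒nonneg p) q r)
      cases (no p)  (yes q) (no r)  = ≡.trans (≡.cong (turn d₁ d₀ ℙ+_) (Parity.+-identityʳ _))
        (≡⇒+≡0 (≡.sym (turn-right (avoids-rotate av) q (≮0⇒nonneg r) (≮0⇒nonneg p))))
      cases (yes p) (no q)  (yes r) = ≡.trans (≡.cong (turn d₀ d₁ ℙ+_) (Parity.+-identityʳ _))
        (≡⇒+≡0 (≡.sym (turn-left (avoids-rotate av) (≮0⇒nonneg q) r p)))
      cases (no p)  (no q)  (yes r) =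
        ≡⇒+≡0 (≡.sym (turn-right (avoids-rotate (avoids-rotate av)) r (≮0⇒nonneg p) (≮0⇒nonneg q)))
      cases (yes p) (yes q) (no r)  =
        ≡⇒+≡0 (≡.sym (turn-left (avoids-rotate (avoids-rotate av)) (≮0⇒nonneg r) p q))

    -- Both sides are the parity of the number of times the difference of a
    -- point of one segment and a point of the other crosses the ray, along
    -- the boundary of the parallelogram of all differences.
    χ-parallelogram : ∀ e₀ e₁ f₀ f₁ →
      (∀ t u → InUnitInterval t → InUnitInterval u →
         ¬ (e₀ +ₚ t · (e₁ -ₚ e₀) ≈ₚ f₀ +ₚ u · (f₁ -ₚ f₀))) →
      χ (f₀ -ₚ e₀) (f₁ -ₚ e₀) ℙ+ χ (f₀ -ₚ e₁) (f₁ -ₚ e₁) ≡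
      χ (f₀ -ₚ e₀) (f₀ -ₚ e₁) ℙ+ χ (f₁ -ₚ e₀) (f₁ -ₚ e₁)
    χ-parallelogram e₀ e₁ f₀ f₁ disjoint = arithmetic (χ (f₀ -ₚ e₀) (f₁ -ₚ e₀)) (χ (f₀ -ₚ e₁) (f₁ -ₚ e₁)) (χ (f₀ -ₚ e₀) (f₀ -ₚ e₁))
        (χ (f₁ -ₚ e₀) (f₁ -ₚ e₁)) (χ (f₁ -ₚ e₁) (f₀ -ₚ e₀))
      -- The diagonal from `f₀ -ₚ e₀` to `f₁ -ₚ e₁` cuts the parallelogram into two triangles, and
      -- its own contribution cancels modulo 2.
      (χ-triangle (f₀ -ₚ e₀) (f₁ -ₚ e₀) (f₁ -ₚ e₁) upper)
      (χ-triangle (f₀ -ₚ e₀) (f₀ -ₚ e₁) (f₁ -ₚ e₁) lower)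
      where
      arithmetic : ∀ u₀ u₁ d₀ d₁ x → u₀ ℙ+ (d₁ ℙ+ x) ≡ 0ℙ → d₀ ℙ+ (u₁ ℙ+ x) ≡ 0ℙ →
                   u₀ ℙ+ u₁ ≡ d₀ ℙ+ d₁
      arithmetic u₀ u₁ d₀ d₁ x eq eq′
        with ≡.refl ← +≡0⇒≡ u₀ (d₁ ℙ+ x) eq | ≡.refl ← +≡0⇒≡ d₀ (u₁ ℙ+ x) eq′ =
        xy∙z≈zy∙x d₁ x u₁

      -- Here `s` is the sum of the weights. Writing it in place of 1 makes each `identity` below a
      -- polynomial identity.
      coordinate : ∀ {s e₀ f₀ h x y} → s ≈ 1# → h ≈ 0# →
                   f₀ * s + y ≈ (e₀ * s + x) + h → e₀ + x ≈ f₀ + y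
      coordinate {s} {e₀} {f₀} {h} {x} {y} s≈1 h≈0 eq = sym (begin
        f₀ + y              ≈⟨ +-congʳ (trans (sym (*-identityʳ f₀)) (*-congˡ (sym s≈1))) ⟩
        f₀ * s + y          ≈⟨ eq ⟩
        (e₀ * s + x) + h    ≈⟨ +-congˡ h≈0 ⟩
        (e₀ * s + x) + 0#   ≈⟨ +-identityʳ _ ⟩
        e₀ * s + x          ≈⟨ +-congʳ (trans (*-congˡ s≈1) (*-identityʳ e₀)) ⟩
        e₀ + x              ∎)

      unit-c : ∀ {a b c} → 0# ≤ a → 0# ≤ b → 0# ≤ c → (a + b) + c ≈ 1# → InUnitInterval c
      unit-c 0≤a 0≤b 0≤c s≈1 = 0≤c , x+y≈1⇒y≤1 s≈1 (nonneg+nonneg 0≤a 0≤b)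

      unit-bc : ∀ {a b c} → 0# ≤ a → 0# ≤ b → 0# ≤ c → (a + b) + c ≈ 1# → InUnitInterval (b + c)
      unit-bc 0≤a 0≤b 0≤c s≈1 = nonneg+nonneg 0≤b 0≤c , x+y≈1⇒y≤1 (trans (sym (+-assoc _ _ _)) s≈1) 0≤a

      -- A convex combination of these corners is the point of the second segment at `b + c` minus
      -- the point of the first at `c`, hence nonzero. In `lower` the two parameters are exchanged.
      upper : Avoids (f₀ -ₚ e₀) (f₁ -ₚ e₀) (f₁ -ₚ e₁)
      upper a b c 0≤a 0≤b 0≤c s≈1 (p , q) =
        disjoint c (b + c) (unit-c 0≤a 0≤b 0≤c s≈1) (unit-bc 0≤a 0≤b 0≤c s≈1)
          (coordinate s≈1 p (identity a b c _ _ _ _) , coordinate s≈1 q (identity a b c _ _ _ _))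
        where
        identity : ∀ a b c e₀ e₁ f₀ f₁ →
          f₀ * ((a + b) + c) + (b + c) * (f₁ - f₀) ≈
          (e₀ * ((a + b) + c) + c * (e₁ - e₀)) +
            ((a * (f₀ - e₀) + b * (f₁ - e₀)) + c * (f₁ - e₁))
        identity = solve 7 (λ a b c e₀ e₁ f₀ f₁ →
          f₀ :* ((a :+ b) :+ c) :+ (b :+ c) :* (f₁ :- f₀) :=
          (e₀ :* ((a :+ b) :+ c) :+ c :* (e₁ :- e₀)) :+
            ((a :* (f₀ :- e₀) :+ b :* (f₁ :- e₀)) :+ c :* (f₁ :- e₁))) refl

      lower : Avoids (f₀ -ₚ e₀) (f₀ -ₚ e₁) (f₁ -ₚ e₁)
      lower a b c 0≤a 0≤b 0≤c s≈1 (p , q) =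
        disjoint (b + c) c (unit-bc 0≤a 0≤b 0≤c s≈1) (unit-c 0≤a 0≤b 0≤c s≈1)
          (coordinate s≈1 p (identity a b c _ _ _ _) , coordinate s≈1 q (identity a b c _ _ _ _))
        where
        identity : ∀ a b c e₀ e₁ f₀ f₁ →
          f₀ * ((a + b) + c) + c * (f₁ - f₀) ≈
          (e₀ * ((a + b) + c) + (b + c) * (e₁ - e₀)) +
            ((a * (f₀ - e₀) + b * (f₀ - e₁)) + c * (f₁ - e₁))
        identity = solve 7 (λ a b c e₀ e₁ f₀ f₁ →
          f₀ :* ((a :+ b) :+ c) :+ c :* (f₁ :- f₀) :=
          (e₀ :* ((a :+ b) :+ c) :+ (b :+ c) :* (e₁ :- e₀)) :+
            ((a :* (f₀ :- e₀) :+ b :* (f₀ :- e₁)) :+ c :* (f₁ :- e₁))) refl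

    -- The cross products of `d` and of `f` with their sum `g` equal those with each other, so the
    -- turns agree. Since `cross l g` is the sum of `cross l d` and `cross l f`, `g` is never alone
    -- on its side.
    χ-corner : ∀ d f g → g ≈ₚ d +ₚ f → χ d g ℙ+ χ g f ≡ χ d f
    χ-corner d@(x , y) f@(x′ , y′) g@(x″ , y″) (x″≈ , y″≈) =
      cases (right? d) (right? g) (right? f)
      where
      cross-g : ∀ a b → cross (a , b) g ≈ cross (a , b) d + cross (a , b) f
      cross-g a b = begin
        a * y″ - b * x″                   ≈⟨ +-cong (*-congˡ y″≈) (-‿cong (*-congˡ x″≈)) ⟩
        a * (y + y′) - b * (x + x′)       ≈⟨ solve 6 (λ a b x y x′ y′ → a :* (y :+ y′) :- b :* (x :+ x′) := det a b x y :+ det a b x′ y′) refl a b x y x′ y′ ⟩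
        (a * y - b * x) + (a * y′ - b * x′)  ∎

      dg≈df : cross d g ≈ cross d f
      dg≈df = trans (cross-g x y) (trans (+-congʳ (cross-self d)) (+-identityˡ _))
      fg≈fd : cross f g ≈ cross f d
      fg≈fd = trans (cross-g x′ y′) (trans (+-congˡ (cross-self f)) (+-identityʳ _))
      swap : ∀ {a b a′ b′} → cross a b ≈ cross a′ b′ → cross b a ≈ cross b′ a′
      swap {a} {b} {a′} {b′} eq = trans (sym (cross-anti a b)) (trans (-‿cong eq) (cross-anti a′ b′))

      turn-cong : ∀ {a b a′ b′} → cross a b ≈ cross a′ b′ → turn a b ≡ turn a′ b′
      turn-cong eq = indicator-cong _ _ (<-respʳ-≈ eq) (<-respʳ-≈ (sym eq))

      cases : (p : Dec (Right d)) (q : Dec (Right g)) (r : Dec (Right f)) →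
        crossing p q (turn d g) (turn g d) ℙ+ crossing q r (turn g f) (turn f g)
          ≡ crossing p r (turn d f) (turn f d)
      cases (yes _) (yes _) (yes _) = ≡.refl
      cases (no _)  (no _)  (no _)  = ≡.refl
      cases (yes _) (yes _) (no _)  = turn-cong (swap fg≈fd)
      cases (yes _) (no _)  (no _)  = ≡.trans (Parity.+-identityʳ _) (turn-cong dg≈df)
      cases (no _)  (no _)  (yes _) = turn-cong fg≈fd
      cases (no _)  (yes _) (yes _) = ≡.trans (Parity.+-identityʳ _) (turn-cong (swap dg≈df))
      cases (yes p) (no q)  (yes r) = contradiction (<-respˡ-≈ (-‿involutive _) (pos⇒-neg
        (<-respʳ-≈ (trans (-‿+-comm _ _) (-‿cong (sym (cross-g (proj₁ l) (proj₂ l)))))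
          (pos+nonneg (neg⇒-pos p) (inj₁ (neg⇒-pos r)))))) q
      cases (no p)  (yes q) (no r)  = contradiction q (nonneg⇒≮0
        (nonneg-resp (sym (cross-g (proj₁ l) (proj₂ l)))
          (nonneg+nonneg (≮0⇒nonneg p) (≮0⇒nonneg r))))

    -- Winding numbers as crossing parities.

    s-pos : ∀ {a b} → 0# < cross a b → s a b ≡ ℤ.1ℤ
    s-pos {a} {b} 0<c with compare (cross a b) 0#
    ... | tri< _ _ ≯ = contradiction 0<c ≯
    ... | tri≈ _ _ ≯ = contradiction 0<c ≯
    ... | tri> _ _ _ = ≡.refl

    s-neg : ∀ {a b} → cross a b < 0# → s a b ≡ ℤ.-1ℤ
    s-neg {a} {b} c<0 with compare (cross a b) 0#
    ... | tri< _ _ _ = ≡.refl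
    ... | tri≈ ≮ _ _ = contradiction c<0 ≮
    ... | tri> ≮ _ _ = contradiction c<0 ≮

    s-nonpos : ∀ {a b} → ¬ (0# < cross a b) → s a b ≡ ℤ.0ℤ ⊎ s a b ≡ ℤ.-1ℤ
    s-nonpos {a} {b} ≯ with compare (cross a b) 0#
    ... | tri< _ _ _ = inj₂ ≡.refl
    ... | tri≈ _ _ _ = inj₁ ≡.refl
    ... | tri> _ _ 0<c = contradiction 0<c ≯

    s-nonneg : ∀ {a b} → ¬ (cross a b < 0#) → s a b ≡ ℤ.0ℤ ⊎ s a b ≡ ℤ.1ℤ
    s-nonneg {a} {b} ≮ with compare (cross a b) 0#
    ... | tri< c<0 _ _ = contradiction c<0 ≮
    ... | tri≈ _ _ _ = inj₁ ≡.refl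
    ... | tri> _ _ _ = inj₂ ≡.refl

    -- The formula of `wind` for arbitrary vectors; at edge directions the two agree by computation.
    winding : Point → Point → ℤ
    winding a b =
      if does ((s a b ℤ.≟ s a l) ×-dec (s a l ℤ.≟ s l b)) then s a b else ℤ.0ℤ

    -- For vectors not parallel to `l`, the condition `s a l ≡ s l b` says that they lie on
    -- different sides. The condition on `s a b` then selects the turn through `l` rather than
    -- through its opposite.
    winding-parity : ∀ a b → ¬ (cross l a ≈ 0#) → ¬ (cross l b ≈ 0#) →
                     parityℤ (winding a b) ≡ χ a b
    winding-parity a b a∦l b∦l = cases (right? a) (right? b) (0# <? cross a b) (0# <? cross b a)
      where
      left-pos : ∀ {d} → ¬ (cross l d ≈ 0#) → Left d → 0# < cross l d
      left-pos d∦l (inj₁ 0<) = 0<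
      left-pos d∦l (inj₂ 0≈) = contradiction (sym 0≈) d∦l

      right⇒s : ∀ {d} → Right d → s d l ≡ ℤ.1ℤ
      right⇒s r = s-pos (<-respʳ-≈ (cross-anti l _) (neg⇒-pos r))

      left⇒s : ∀ {d} → ¬ (cross l d ≈ 0#) → Left d → s d l ≡ ℤ.-1ℤ
      left⇒s d∦l lf = s-neg (<-respˡ-≈ (cross-anti l _) (pos⇒-neg (left-pos d∦l lf)))

      anti : ∀ {d e} → 0# < cross d e → cross e d < 0#
      anti 0<c = <-respˡ-≈ (cross-anti _ _) (pos⇒-neg 0<c)

      anti′ : ∀ {d e} → cross d e < 0# → 0# < cross e d
      anti′ c<0 = <-respʳ-≈ (cross-anti _ _) (neg⇒-pos c<0)

      cases : (p : Dec (Right a)) (q : Dec (Right b))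
              (r : Dec (0# < cross a b)) (t : Dec (0# < cross b a)) →
              parityℤ (winding a b) ≡ crossing p q (indicator r) (indicator t)
      cases (yes p) (yes q) _ _ rewrite right⇒s p | s-neg q
        with compare (cross a b) 0#
      ... | tri< _ _ _ = ≡.refl
      ... | tri≈ _ _ _ = ≡.refl
      ... | tri> _ _ _ = ≡.refl
      cases (no p) (no q) _ _
        rewrite left⇒s a∦l (≮0⇒nonneg p) | s-pos {l} {b} (left-pos b∦l (≮0⇒nonneg q))
        with compare (cross a b) 0#
      ... | tri< _ _ _ = ≡.refl
      ... | tri≈ _ _ _ = ≡.refl
      ... | tri> _ _ _ = ≡.refl
      cases (yes p) (no q) (yes r) _
        rewrite right⇒s p | s-pos {l} {b} (left-pos b∦l (≮0⇒nonneg q)) | s-pos {a} {b} r = ≡.refl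
      cases (yes p) (no q) (no r) _
        rewrite right⇒s p | s-pos {l} {b} (left-pos b∦l (≮0⇒nonneg q)) with s-nonpos {a} {b} r
      ... | inj₁ eq rewrite eq = ≡.refl
      ... | inj₂ eq rewrite eq = ≡.refl
      cases (no p) (yes q) _ (yes t)
        rewrite left⇒s a∦l (≮0⇒nonneg p) | s-neg q | s-neg (anti t) = ≡.refl
      cases (no p) (yes q) _ (no t)
        rewrite left⇒s a∦l (≮0⇒nonneg p) | s-neg q with s-nonneg {a} {b} (λ c<0 → t (anti′ c<0))
      ... | inj₁ eq rewrite eq = ≡.refl
      ... | inj₂ eq rewrite eq = ≡.refl

    -- Segments in a half plane bounded by a line of direction `m`.

    module HalfPlane (m : Point) (l-inside : cross m l < 0#) where

      private
        -- The three-term Plücker relation for `m`, `l`, `d` and `e`.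
        relation : ∀ d e → cross d e * - cross m l ≈ - cross m d * cross l e + - cross m e * - cross l d
        relation (d₁ , d₂) (e₁ , e₂) = solve 8 (λ m₁ m₂ l₁ l₂ d₁ d₂ e₁ e₂ →
          det d₁ d₂ e₁ e₂ :* (:- det m₁ m₂ l₁ l₂) :=
          :- det m₁ m₂ d₁ d₂ :* det l₁ l₂ e₁ e₂ :+ :- det m₁ m₂ e₁ e₂ :* :- det l₁ l₂ d₁ d₂)
          refl (proj₁ m) (proj₂ m) (proj₁ l) (proj₂ l) d₁ d₂ e₁ e₂

        factor-nonneg : ∀ {x y} → 0# < y → 0# ≤ x * y → 0# ≤ x
        factor-nonneg {x} {y} 0<y 0≤xy = ≮0⇒nonneg λ x<0 → pos⇒≉0
          (pos+nonneg (*-pos (neg⇒-pos x<0) 0<y) 0≤xy)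
          (solve 2 (λ x y → :- x :* y :+ x :* y := con ℤ.0ℤ) refl x y)

        0<-ml : 0# < - cross m l
        0<-ml = neg⇒-pos l-inside

        -- `relation` makes a positive multiple of `cross d e` a sum of nonnegative terms. If it
        -- vanished, `cramer` would put the origin on the segment from `d` to `e`, regarded here as
        -- a triangle with a doubled vertex.
        turn-inside : ∀ {d e} → 0# ≤ - cross m d → 0# ≤ - cross m e → Avoids d d e →
                      Right d → Left e → 0# < cross d e
        turn-inside {d} {e} d-in e-in avoids d-right e-left = strict
          (factor-nonneg 0<-ml (nonneg-resp (sym (relation d e))
            (nonneg+nonneg (nonneg*nonneg d-in e-left)
                           (nonneg*nonneg e-in (inj₁ (neg⇒-pos d-right))))))
          where
          strict : 0# ≤ cross d e → 0# < cross d e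
          strict (inj₁ 0<c) = 0<c
          strict (inj₂ 0≈c) = contradiction
              (combine (proj₁ (cramer l d e)) , combine (proj₂ (cramer l d e)))
              (avoids-scale avoids (cross l e) 0# (- cross l d)
                e-left (inj₂ refl) (inj₁ (neg⇒-pos d-right))
                (nonneg+pos (nonneg+nonneg e-left (inj₂ refl)) (neg⇒-pos d-right)))
            where
            combine : ∀ {z x y} → (cross d e * z + cross e l * x) + cross l d * y ≈ 0# →
                      (cross l e * x + 0# * x) + - cross l d * y ≈ 0#
            combine {z} {x} {y} eq = begin
              (cross l e * x + 0# * x) + - cross l d * y
                ≈⟨ +-congʳ (+-cong (*-congʳ (sym (cross-anti e l))) (*-congʳ 0≈c)) ⟩
              (- cross e l * x + cross d e * x) + - cross l d * y
                ≈⟨ solve 6 (λ E c D z x y → (:- E :* x :+ c :* x) :+ :- D :* y :=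
                               c :* (x :+ z) :+ :- ((c :* z :+ E :* x) :+ D :* y)) refl
                     (cross e l) (cross d e) (cross l d) z x y ⟩
              cross d e * (x + z) + - ((cross d e * z + cross e l * x) + cross l d * y)
                ≈⟨ +-cong (trans (*-congʳ (sym 0≈c)) (zeroˡ _)) (trans (-‿cong eq) -0#≈0#) ⟩
              0# + 0#
                ≈⟨ +-identityˡ 0# ⟩
              0# ∎

        -- With the signs of `cross m d` and `cross m e` reversed, `relation` bounds `cross d e`
        -- from the other side.
        turn-outside : ∀ {d e} → 0# ≤ cross m d → 0# ≤ cross m e →
                       Right d → Left e → ¬ (0# < cross d e)
        turn-outside {d} {e} d-out e-out d-right e-left 0<c = pos⇒≉0
          (pos+nonneg (pos+nonneg (*-pos 0<c 0<-ml) (nonneg*nonneg d-out e-left))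
                      (nonneg*nonneg e-out (inj₁ (neg⇒-pos d-right))))
          (begin
            (cross d e * - cross m l + cross m d * cross l e) + cross m e * - cross l d
              ≈⟨ +-congʳ (+-congʳ (relation d e)) ⟩
            ((- cross m d * cross l e + - cross m e * - cross l d) + cross m d * cross l e) + cross m e * - cross l d
              ≈⟨ solve 4 (λ a b c d → ((:- a :* b :+ :- c :* d) :+ a :* b) :+ c :* d := con ℤ.0ℤ) refl
                   (cross m d) (cross l e) (cross m e) (- cross l d) ⟩
            0# ∎)

      -- Only the ray itself, and not the opposite one, enters this half plane, so every change of
      -- side is a crossing of the ray.
      χ-inside : ∀ d e → 0# ≤ - cross m d → 0# ≤ - cross m e → Avoids d d e →
                 χ d e ≡ side d ℙ+ side e
      χ-inside d e d-in e-in avoids = cases (right? d) (right? e)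
        where
        reversed : Avoids e e d
        reversed a b c 0≤a 0≤b 0≤c eq (p , q) =
          avoids c 0# (a + b) 0≤c (inj₂ refl) (nonneg+nonneg 0≤a 0≤b)
            (trans (solve 3 (λ a b c → (c :+ con ℤ.0ℤ) :+ (a :+ b) := (a :+ b) :+ c) refl a b c) eq)
            (trans (rearrange _ _) p , trans (rearrange _ _) q)
          where
          rearrange : ∀ x y → (c * x + 0# * x) + (a + b) * y ≈ (a * y + b * y) + c * x
          rearrange = solve 5 (λ a b c x y → (c :* x :+ con ℤ.0ℤ :* x) :+ (a :+ b) :* y :=
                                 (a :* y :+ b :* y) :+ c :* x) refl a b c
        cases : (p : Dec (Right d)) (q : Dec (Right e)) →
                crossing p q (turn d e) (turn e d) ≡ indicator p ℙ+ indicator q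
        cases (yes p) (yes q) = ≡.refl
        cases (no p)  (no q)  = ≡.refl
        cases (yes p) (no q)  = indicator-yes _ (turn-inside d-in e-in avoids p (≮0⇒nonneg q))
        cases (no p)  (yes q) = indicator-yes _ (turn-inside e-in d-in reversed q (≮0⇒nonneg p))

      χ-outside : ∀ d e → 0# ≤ cross m d → 0# ≤ cross m e → χ d e ≡ 0ℙ
      χ-outside d e d-out e-out = cases (right? d) (right? e)
        where
        cases : (p : Dec (Right d)) (q : Dec (Right e)) →
                crossing p q (turn d e) (turn e d) ≡ 0ℙ
        cases (yes p) (yes q) = ≡.refl
        cases (no p)  (no q)  = ≡.refl
        cases (yes p) (no q)  = indicator-no _ (turn-outside d-out e-out p (≮0⇒nonneg q))
        cases (no p)  (yes q) = indicator-no _ (turn-outside e-out d-out q (≮0⇒nonneg p))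

    -- Meetings of an edge with a ray from an arbitrary point.

    module Ray (b a c : Point) (a∉ray : ∀ t → 0# < t → ¬ (a ≈ₚ b +ₚ t · l))
               (c∉ray : ∀ t → 0# < t → ¬ (c ≈ₚ b +ₚ t · l))
               (∦ : ¬ (cross l (c -ₚ a) ≈ 0#)) where

      private
        d e : Point
        d = a -ₚ b
        e = c -ₚ b

        -- Division by `p + q` turns the combination into a point of the segment, at the parameter
        -- given by the share of `e`.
        meets : ∀ k p q → 0# < k → 0# ≤ p → 0# ≤ q → 0# < p + q →
                k · l ≈ₚ p · d +ₚ q · e → RayMeets b l a (c -ₚ a)
        meets k p q 0<k 0≤p 0≤q 0<s (eq₁ , eq₂) with invertible (p + q) (pos⇒≉0 0<s)
        ... | r , sr≈1 = k * r , q * r , *-pos 0<k 0<r ,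
            (nonneg*nonneg 0≤q (inj₁ 0<r) ,
             x+y≈1⇒y≤1 (trans (sym (distribʳ r p q)) sr≈1) (nonneg*nonneg 0≤p (inj₁ 0<r))) ,
            coordinate eq₁ , coordinate eq₂
          where
          0<r : 0# < r
          0<r = inverse-pos sr≈1 0<s
          coordinate : ∀ {l b a c} → k * l ≈ p * (a - b) + q * (c - b) →
                       b + k * r * l ≈ a + q * r * (c - a)
          coordinate {l} {b} {a} {c} eq = begin
            b + k * r * l                     ≈⟨ solve 4 (λ b k r l → b :+ k :* r :* l := b :+ r :* (k :* l)) refl b k r l ⟩
            b + r * (k * l)                   ≈⟨ +-congˡ (*-congˡ eq) ⟩
            b + r * (p * (a - b) + q * (c - b))
              ≈⟨ solve 6 (λ a b c p q r → b :+ r :* (p :* (a :- b) :+ q :* (c :- b)) :=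
                            (b :+ ((p :+ q) :* r) :* (a :- b)) :+ q :* r :* (c :- a)) refl a b c p q r ⟩
            (b + ((p + q) * r) * (a - b)) + q * r * (c - a)
              ≈⟨ +-congʳ (+-congˡ (*-congʳ sr≈1)) ⟩
            (b + 1# * (a - b)) + q * r * (c - a)
              ≈⟨ +-congʳ (solve 2 (λ a b → b :+ con ℤ.1ℤ :* (a :- b) := a) refl a b) ⟩
            a + q * r * (c - a)               ∎

        -- `cramer` solved for `l` expresses a positive multiple of it by nonnegative multiples of
        -- `d` and `e`.
        meets-right : Right d → Left e → 0# < cross d e → RayMeets b l a (c -ₚ a)
        meets-right r lf 0<k = meets (cross d e) (cross l e) (- cross l d) 0<k lf
          (inj₁ (neg⇒-pos r)) (nonneg+pos lf (neg⇒-pos r))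
          (coordinate (proj₁ (cramer l d e)) , coordinate (proj₂ (cramer l d e)))
          where
          coordinate : ∀ {z x y} → (cross d e * z + cross e l * x) + cross l d * y ≈ 0# →
                       cross d e * z ≈ cross l e * x + - cross l d * y
          coordinate {z} {x} {y} eq = begin
            cross d e * z
              ≈⟨ solve 6 (λ k E D z x y → k :* z := ((k :* z :+ E :* x) :+ D :* y) :+ (:- E :* x :+ :- D :* y)) refl
                   (cross d e) (cross e l) (cross l d) z x y ⟩
            ((cross d e * z + cross e l * x) + cross l d * y) + (- cross e l * x + - cross l d * y)
              ≈⟨ +-congʳ eq ⟩
            0# + (- cross e l * x + - cross l d * y)
              ≈⟨ +-identityˡ _ ⟩
            - cross e l * x + - cross l d * y
              ≈⟨ +-congʳ (*-congʳ (cross-anti e l)) ⟩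
            cross l e * x + - cross l d * y ∎

        meets-left : Left d → Right e → 0# < cross e d → RayMeets b l a (c -ₚ a)
        meets-left lf r 0<k = meets (cross e d) (- cross l e) (cross l d) 0<k
          (inj₁ (neg⇒-pos r)) lf (pos+nonneg (neg⇒-pos r) lf)
          (coordinate (proj₁ (cramer l d e)) , coordinate (proj₂ (cramer l d e)))
          where
          coordinate : ∀ {z x y} → (cross d e * z + cross e l * x) + cross l d * y ≈ 0# →
                       cross e d * z ≈ - cross l e * x + cross l d * y
          coordinate {z} {x} {y} eq = begin
            cross e d * z
              ≈⟨ *-congʳ (sym (cross-anti d e)) ⟩
            - cross d e * z
              ≈⟨ solve 6 (λ k E D z x y → :- k :* z := (E :* x :+ D :* y) :- ((k :* z :+ E :* x) :+ D :* y)) refl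
                   (cross d e) (cross e l) (cross l d) z x y ⟩
            (cross e l * x + cross l d * y) - ((cross d e * z + cross e l * x) + cross l d * y)
              ≈⟨ +-cong (+-congʳ (*-congʳ (sym (cross-anti l e)))) (trans (-‿cong eq) -0#≈0#) ⟩
            (- cross l e * x + cross l d * y) + 0#
              ≈⟨ +-identityʳ _ ⟩
            - cross l e * x + cross l d * y ∎

        module Meeting (t u : Carrier) (0<t : 0# < t) (0≤u : 0# ≤ u) (u≤1 : u ≤ 1#)
                       (eq : b +ₚ t · l ≈ₚ a +ₚ u · (c -ₚ a)) where
          0≤1-u : 0# ≤ 1# - u
          0≤1-u = y≤1⇒0≤1-y u≤1

          coordinate : ∀ {l b a c} → b + t * l ≈ a + u * (c - a) →
                       t * l ≈ (1# - u) * (a - b) + u * (c - b)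
          coordinate {l} {b} {a} {c} eq = begin
            t * l                     ≈⟨ solve 2 (λ b x → x := (b :+ x) :- b) refl b (t * l) ⟩
            (b + t * l) - b           ≈⟨ +-congʳ eq ⟩
            (a + u * (c - a)) - b     ≈⟨ solve 4 (λ a b c u → (a :+ u :* (c :- a)) :- b :=
                                           (con ℤ.1ℤ :- u) :* (a :- b) :+ u :* (c :- b)) refl a b c u ⟩
            (1# - u) * (a - b) + u * (c - b)  ∎

          position : t · l ≈ₚ (1# - u) · d +ₚ u · e
          position = coordinate (proj₁ eq) , coordinate (proj₂ eq)

          -- With `p` equal to `l`, `d` or `e` one of the three cross products vanishes, which
          -- leaves a relation between the other two.
          cross-position : ∀ p → t * cross p l ≈ (1# - u) * cross p d + u * cross p e
          cross-position (p₁ , p₂) = begin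
            t * (p₁ * proj₂ l - p₂ * proj₁ l)
              ≈⟨ solve 5 (λ t p₁ p₂ l₁ l₂ → t :* (p₁ :* l₂ :- p₂ :* l₁) := p₁ :* (t :* l₂) :- p₂ :* (t :* l₁))
                   refl t p₁ p₂ (proj₁ l) (proj₂ l) ⟩
            p₁ * (t * proj₂ l) - p₂ * (t * proj₁ l)
              ≈⟨ +-cong (*-congˡ (proj₂ position)) (-‿cong (*-congˡ (proj₁ position))) ⟩
            p₁ * ((1# - u) * proj₂ d + u * proj₂ e) - p₂ * ((1# - u) * proj₁ d + u * proj₁ e)
              ≈⟨ solve 8 (λ v u p₁ p₂ d₁ d₂ e₁ e₂ → p₁ :* (v :* d₂ :+ u :* e₂) :- p₂ :* (v :* d₁ :+ u :* e₁)
                            := v :* det p₁ p₂ d₁ d₂ :+ u :* det p₁ p₂ e₁ e₂)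
                   refl (1# - u) u p₁ p₂ (proj₁ d) (proj₂ d) (proj₁ e) (proj₂ e) ⟩
            (1# - u) * cross (p₁ , p₂) d + u * cross (p₁ , p₂) e ∎

          balance : (1# - u) * cross l d + u * cross l e ≈ 0#
          balance = trans (sym (cross-position l)) (trans (*-congˡ (cross-self l)) (zeroʳ t))

          factor-pos : ∀ {x v y} → 0# < x → 0# ≤ v → t * x ≈ v * y → 0# < y
          factor-pos {x} {v} {y} 0<x 0≤v eq with 0# <? y
          ... | yes 0<y = 0<y
          ... | no ≮ = contradiction
              (trans (+-congʳ eq) (solve 2 (λ v y → v :* y :+ v :* :- y := con ℤ.0ℤ) refl v y))
              (pos⇒≉0 (pos+nonneg (*-pos 0<t 0<x) (nonneg*nonneg 0≤v (≯0⇒-nonneg ≮))))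

          turns-right : Right d → 0# < cross d e
          turns-right r = factor-pos (<-respʳ-≈ (cross-anti l d) (neg⇒-pos r)) 0≤u
            (trans (cross-position d)
              (trans (+-congʳ (trans (*-congˡ (cross-self d)) (zeroʳ _))) (+-identityˡ _)))

          turns-left : Right e → 0# < cross e d
          turns-left r = factor-pos (<-respʳ-≈ (cross-anti l e) (neg⇒-pos r)) 0≤1-u
            (trans (cross-position e)
              (trans (+-congˡ (trans (*-congˡ (cross-self e)) (zeroʳ _))) (+-identityʳ _)))

          not-both-right : Right d → ¬ Right e
          not-both-right r r′ = case 0≤u
            where
            case : ¬ (0# ≤ u)
            case (inj₁ 0<u) = pos⇒≉0
              (nonneg+pos (nonneg*nonneg 0≤1-u (inj₁ (neg⇒-pos r))) (*-pos 0<u (neg⇒-pos r′)))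
              (trans (solve 4 (λ v x u y → v :* :- x :+ u :* :- y := :- (v :* x :+ u :* y)) refl
                       (1# - u) (cross l d) u (cross l e))
                (trans (-‿cong balance) -0#≈0#))
            case (inj₂ 0≈u) = neg⇒≉0 r (begin
              cross l d
                ≈⟨ solve 2 (λ x y → x := (con ℤ.1ℤ :- con ℤ.0ℤ) :* x :+ con ℤ.0ℤ :* y) refl (cross l d) (cross l e) ⟩
              (1# - 0#) * cross l d + 0# * cross l e
                ≈⟨ +-cong (*-congʳ (+-congˡ (-‿cong 0≈u))) (*-congʳ 0≈u) ⟩
              (1# - u) * cross l d + u * cross l e
                ≈⟨ balance ⟩
              0# ∎)

          -- Points of the line count as left, so signs alone do not exclude a meeting. At `u` equal
          -- to 0 or 1 an end of the edge would be on the ray; in between, `balance` puts both ends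
          -- on the line, against `∦`.
          not-both-left : Left d → ¬ Left e
          not-both-left lf lf′ = case 0≤u 0≤1-u
            where
            start-point : ∀ {l b a c} → b + t * l ≈ a + u * (c - a) → 0# ≈ u → a ≈ b + t * l
            start-point {a = a} eq 0≈u = sym (trans eq
              (trans (+-congˡ (trans (*-congʳ (sym 0≈u)) (zeroˡ _))) (+-identityʳ a)))
            end-point : ∀ {l b a c} → b + t * l ≈ a + u * (c - a) → 0# ≈ 1# - u → c ≈ b + t * l
            end-point {l} {b} {a} {c} eq 0≈1-u = sym (begin
              b + t * l                    ≈⟨ eq ⟩
              a + u * (c - a)              ≈⟨ solve 3 (λ a c u → a :+ u :* (c :- a) := c :+ (con ℤ.1ℤ :- u) :* (a :- c)) refl a c u ⟩
              c + (1# - u) * (a - c)       ≈⟨ +-congˡ (trans (*-congʳ (sym 0≈1-u)) (zeroˡ _)) ⟩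
              c + 0#                       ≈⟨ +-identityʳ c ⟩
              c                            ∎)
            case : 0# ≤ u → ¬ (0# ≤ 1# - u)
            case (inj₂ 0≈u) _ = a∉ray t 0<t (start-point (proj₁ eq) 0≈u , start-point (proj₂ eq) 0≈u)
            case _ (inj₂ 0≈) = c∉ray t 0<t (end-point (proj₁ eq) 0≈ , end-point (proj₂ eq) 0≈)
            case (inj₁ 0<u) (inj₁ 0<) = sides lf lf′
              where
              sides : Left d → ¬ Left e
              sides (inj₁ 0<d) _ = pos⇒≉0 (pos+nonneg (*-pos 0< 0<d) (nonneg*nonneg 0≤u lf′)) balance
              sides _ (inj₁ 0<e) = pos⇒≉0 (nonneg+pos (nonneg*nonneg 0≤1-u lf) (*-pos 0<u 0<e)) balance
              sides (inj₂ 0≈d) (inj₂ 0≈e) = ∦ (begin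
                cross l (c -ₚ a)
                  ≈⟨ solve 8 (λ l₁ l₂ a₁ a₂ b₁ b₂ c₁ c₂ → det l₁ l₂ (c₁ :- a₁) (c₂ :- a₂) :=
                         det l₁ l₂ (c₁ :- b₁) (c₂ :- b₂) :- det l₁ l₂ (a₁ :- b₁) (a₂ :- b₂)) refl
                       (proj₁ l) (proj₂ l) (proj₁ a) (proj₂ a) (proj₁ b) (proj₂ b) (proj₁ c) (proj₂ c) ⟩
                cross l e - cross l d   ≈⟨ +-cong (sym 0≈e) (-‿cong (sym 0≈d)) ⟩
                0# - 0#                 ≈⟨ -‿inverseʳ 0# ⟩
                0#                      ∎)

      χ-ray : (r : Dec (RayMeets b l a (c -ₚ a))) → indicator r ≡ χ (a -ₚ b) (c -ₚ b)
      χ-ray r? = cases (right? d) (right? e)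
        where
        cases : (p : Dec (Right d)) (q : Dec (Right e)) →
                indicator r? ≡ crossing p q (turn d e) (turn e d)
        cases (yes p) (yes q) = indicator-no r? λ (t , u , 0<t , (0≤u , u≤1) , eq) →
          Meeting.not-both-right t u 0<t 0≤u u≤1 eq p q
        cases (no p) (no q) = indicator-no r? λ (t , u , 0<t , (0≤u , u≤1) , eq) →
          Meeting.not-both-left t u 0<t 0≤u u≤1 eq (≮0⇒nonneg p) (≮0⇒nonneg q)
        cases (yes p) (no q) = indicator-cong r? _
          (λ (t , u , 0<t , (0≤u , u≤1) , eq) → Meeting.turns-right t u 0<t 0≤u u≤1 eq p)
          (meets-right p (≮0⇒nonneg q))
        cases (no p) (yes q) = indicator-cong r? _
          (λ (t , u , 0<t , (0≤u , u≤1) , eq) → Meeting.turns-left t u 0<t 0≤u u≤1 eq q)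
          (meets-left (≮0⇒nonneg p) q)

  cross-difference : ∀ m p q r → cross m (p -ₚ r) - cross m (q -ₚ r) ≈ cross m (p -ₚ q)
  cross-difference (m₁ , m₂) (p₁ , p₂) (q₁ , q₂) (r₁ , r₂) = solve 8
    (λ m₁ m₂ p₁ p₂ q₁ q₂ r₁ r₂ →
      det m₁ m₂ (p₁ :- r₁) (p₂ :- r₂) :- det m₁ m₂ (q₁ :- r₁) (q₂ :- r₂)
      := det m₁ m₂ (p₁ :- q₁) (p₂ :- q₂)) refl m₁ m₂ p₁ p₂ q₁ q₂ r₁ r₂

  cross-along : ∀ m l b p t → p ≈ₚ b +ₚ t · l → cross m (p -ₚ b) ≈ t * cross m l
  cross-along (m₁ , m₂) (l₁ , l₂) (b₁ , b₂) (p₁ , p₂) t (eq₁ , eq₂) = begin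
    m₁ * (p₂ - b₂) - m₂ * (p₁ - b₁)
      ≈⟨ +-cong (*-congˡ (+-congʳ eq₂)) (-‿cong (*-congˡ (+-congʳ eq₁))) ⟩
    m₁ * ((b₂ + t * l₂) - b₂) - m₂ * ((b₁ + t * l₁) - b₁)
      ≈⟨ solve 7 (λ m₁ m₂ b₁ b₂ l₁ l₂ t →
           m₁ :* ((b₂ :+ t :* l₂) :- b₂) :- m₂ :* ((b₁ :+ t :* l₁) :- b₁)
           := t :* det m₁ m₂ l₁ l₂) refl m₁ m₂ b₁ b₂ l₁ l₂ t ⟩
    t * (m₁ * l₂ - m₂ * l₁) ∎

  -- The two copies of `p -ₚ b` share one weight, and the weight `z` of `q -ₚ b` is the parameter on
  -- the segment.
  off-segment⇒avoids : ∀ {b p q} → (∀ t → InUnitInterval t → ¬ (b ≈ₚ p +ₚ t · (q -ₚ p))) →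
                       Avoids (p -ₚ b) (p -ₚ b) (q -ₚ b)
  off-segment⇒avoids off x y z 0≤x 0≤y 0≤z s≈1 (eq₁ , eq₂) =
    off z (0≤z , x+y≈1⇒y≤1 s≈1 (nonneg+nonneg 0≤x 0≤y)) (coordinate eq₁ , coordinate eq₂)
    where
    coordinate : ∀ {b p q} → (x * (p - b) + y * (p - b)) + z * (q - b) ≈ 0# →
                 b ≈ p + z * (q - p)
    coordinate {b} {p} {q} eq = begin
      b                                  ≈⟨ solve 2 (λ b p → b := p :- con ℤ.1ℤ :* (p :- b)) refl b p ⟩
      p - 1# * (p - b)                   ≈⟨ +-congˡ (-‿cong (*-congʳ (sym s≈1))) ⟩
      p - ((x + y) + z) * (p - b)        ≈⟨ solve 6 (λ x y z b p q → p :- ((x :+ y) :+ z) :* (p :- b) :=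
                                              (p :+ z :* (q :- p)) :- ((x :* (p :- b) :+ y :* (p :- b)) :+ z :* (q :- b)))
                                              refl x y z b p q ⟩
      (p + z * (q - p)) - ((x * (p - b) + y * (p - b)) + z * (q - b))
                                         ≈⟨ +-congˡ (trans (-‿cong eq) -0#≈0#) ⟩
      (p + z * (q - p)) + 0#             ≈⟨ +-identityʳ _ ⟩
      p + z * (q - p)                    ∎

  -ₚ-telescope : ∀ a b c → c -ₚ a ≈ₚ (b -ₚ a) +ₚ (c -ₚ b)
  -ₚ-telescope _ _ _ = telescope _ _ _ , telescope _ _ _
    where
    telescope : ∀ a b c → c - a ≈ (b - a) + (c - b)
    telescope = solve 3 (λ a b c → c :- a := (b :- a) :+ (c :- b)) refl

-- Parities of integers and of counts.

parity-suc+suc : ∀ m n → ℕ.parity (suc m) ℙ+ ℕ.parity (suc n) ≡ ℕ.parity m ℙ+ ℕ.parity n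
parity-suc+suc m n = begin
  ℕ.parity (suc m) ℙ+ ℕ.parity (suc n)   ≡⟨ Parity.+-homo-+ (suc m) (suc n) ⟨
  ℕ.parity (suc m ℕ.+ suc n)             ≡⟨ ≡.cong (λ k → ℕ.parity (suc k)) (ℕ.+-suc m n) ⟩
  ℕ.parity (m ℕ.+ n)                     ≡⟨ Parity.+-homo-+ m n ⟩
  ℕ.parity m ℙ+ ℕ.parity n               ∎
  where open ≡.≡-Reasoning

parity-⊖ : ∀ m n → parityℤ (m ℤ.⊖ n) ≡ ℕ.parity m ℙ+ ℕ.parity n
parity-⊖ m       zero    = ≡.sym (Parity.+-identityʳ _)
parity-⊖ zero    (suc n) = ≡.refl
parity-⊖ (suc m) (suc n) = ≡.trans (≡.cong parityℤ (ℤ.[1+m]⊖[1+n]≡m⊖n m n))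
  (≡.trans (parity-⊖ m n) (≡.sym (parity-suc+suc m n)))

parityℤ-+ : ∀ i j → parityℤ (i ℤ.+ j) ≡ parityℤ i ℙ+ parityℤ j
parityℤ-+ (ℤ.+ m)  (ℤ.+ n)  = Parity.+-homo-+ m n
parityℤ-+ (ℤ.+ m)  -[1+ n ] = parity-⊖ m (suc n)
parityℤ-+ -[1+ m ] (ℤ.+ n)  = ≡.trans (parity-⊖ n (suc m)) (Parity.+-comm (ℕ.parity n) _)
parityℤ-+ -[1+ m ] -[1+ n ] =
  ≡.trans (Parity.+-homo-+ m n) (≡.sym (parity-suc+suc m n))

cancel-middle : ∀ x y z → (x ℙ+ y) ℙ+ (y ℙ+ z) ≡ x ℙ+ z
cancel-middle x y z = begin
  (x ℙ+ y) ℙ+ (y ℙ+ z)   ≡⟨ Parity.+-assoc x y (y ℙ+ z) ⟩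
  x ℙ+ (y ℙ+ (y ℙ+ z))   ≡⟨ ≡.cong (x ℙ+_) (Parity.+-assoc y y z) ⟨
  x ℙ+ ((y ℙ+ y) ℙ+ z)   ≡⟨ ≡.cong (λ p → x ℙ+ (p ℙ+ z)) (Parity.p+p≡0ℙ y) ⟩
  x ℙ+ z                 ∎
  where open ≡.≡-Reasoning

∑ℙ : ∀ {A : Set} → List A → (A → Parity) → Parity
∑ℙ []       f = 0ℙ
∑ℙ (x ∷ xs) f = f x ℙ+ ∑ℙ xs f

-- In the application `g` and `h` are the sides of the two ends of an edge, so that counts over
-- consecutive edges telescope.
parity-count : ∀ {A : Set} {P : A → Set} (P? : ∀ x → Dec (P x)) (g h : A → Parity) xs →
               (∀ {x} → x List.∈ xs → indicator (P? x) ≡ g x ℙ+ h x) →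
               ℕ.parity (length (filter P? xs)) ≡ ∑ℙ xs g ℙ+ ∑ℙ xs h
parity-count P? g h []       eq = ≡.refl
parity-count P? g h (x ∷ xs) eq = begin
  ℕ.parity (length (filter P? (x ∷ xs)))                  ≡⟨ head (P? x) ≡.refl ⟩
  indicator (P? x) ℙ+ ℕ.parity (length (filter P? xs))    ≡⟨ ≡.cong₂ _ℙ+_ (eq (here ≡.refl))
                                                               (parity-count P? g h xs (λ x∈ → eq (there x∈))) ⟩
  (g x ℙ+ h x) ℙ+ (∑ℙ xs g ℙ+ ∑ℙ xs h)                    ≡⟨ interchange (g x) _ _ _ ⟩
  (g x ℙ+ ∑ℙ xs g) ℙ+ (h x ℙ+ ∑ℙ xs h)                    ∎
  where
  open ≡.≡-Reasoning
  head : ∀ d → P? x ≡ d → ℕ.parity (length (filter P? (x ∷ xs))) ≡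
         indicator d ℙ+ ℕ.parity (length (filter P? xs))
  head d eq with P? x
  head (yes _) ≡.refl | yes _ = Parity.+-homo-+ 1 (length (filter P? xs))
  head (no _)  ≡.refl | no _  = ≡.refl

-- Paths in a plabic graph.

module PlabicGraph {n} {G : Digraph n} (isPlabic : IsPlabic G) where
  open Digraph G
  open IsPlabic isPlabic

  private
    witness : ∀ {P : Edge → Set} (P? : ∀ e → Dec (P e)) →
              length (filter P? (allFin #edges)) ≢ 0 → ∃ P
    witness P? ≢0 with filter P? (allFin #edges) in eq
    ... | []    = contradiction ≡.refl ≢0
    ... | e ∷ _ = e , proj₂ (List.∈-filter⁻ P? {xs = allFin #edges} (≡.subst (e List.∈_) (≡.sym eq) (here ≡.refl)))

    counted : ∀ {P : Edge → Set} (P? : ∀ e → Dec (P e)) {e} → P e →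
              1 ℕ.≤ length (filter P? (allFin #edges))
    counted P? {e} p = List.∈-length (List.∈-filter⁺ P? (List.∈-allFin e) p)

    suc≢0 : ∀ {m k} → m ≡ suc k → m ≢ 0
    suc≢0 ≡.refl ()

    other : ∀ {a b} → b ≡ 1 → a ℕ.+ b ≡ 2 ⊎ a ℕ.+ b ≡ 3 → a ≢ 0
    other ≡.refl (inj₁ ()) ≡.refl
    other ≡.refl (inj₂ ()) ≡.refl

    degrees : ∀ v → indegree (internal v) ≢ 0 × outdegree (internal v) ≢ 0
    degrees v with colour v in eq
    ... | white = suc≢0 in≡1 , other in≡1 (≡.subst (λ d → d ≡ 2 ⊎ d ≡ 3)
                    (ℕ.+-comm (indegree (internal v)) _) (internal-degree v))
      where
      in≡1 = proj₁ (perfect v) eq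
    ... | black = other out≡1 (internal-degree v) , suc≢0 out≡1
      where
      out≡1 = proj₂ (perfect v) eq

  -- A perfect orientation has no internal sources or sinks, since every
  -- internal vertex has at least two edges.
  in-edge : ∀ v → ∃ λ e → tgt e ≡ internal v
  in-edge v = witness _ (proj₁ (degrees v))

  out-edge : ∀ v → ∃ λ e → src e ≡ internal v
  out-edge v = witness _ (proj₂ (degrees v))

  -- An incoming and an outgoing edge would give the boundary vertex degree at least 2.
  no-through : ∀ {e f j} → tgt e ≡ boundary j → src f ≢ boundary j
  no-through {j = j} p q = ℕ.<⇒≢ (ℕ.+-mono-≤ (counted (λ e → tgt e ≟ᵥ boundary j) p)
                                           (counted (λ e → src e ≟ᵥ boundary j) q))
                               (≡.sym (boundary-degree j))

  source⇒edge : ∀ {i} → i ∈ sources → ∃ λ e → src e ≡ boundary i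
  source⇒edge {i} i∈ with Fin.any? (λ e → src e ≟ᵥ boundary i) in eq
  ... | yes edge = edge
  ... | no _ = contradiction (≡.trans (≡.sym ([]=⇒lookup i∈))
                 (≡.trans (lookup∘tabulate (λ j → does (Fin.any? λ e → src e ≟ᵥ boundary j)) i)
                          (≡.cong does eq))) λ ()

  infixr 5 _++ₚ_
  _++ₚ_ : ∀ {e f v} → Path G e (src f) → Path G f v → Path G e v
  [ p ]   ++ₚ Q = p ∷ Q
  (p ∷ P) ++ₚ Q = p ∷ (P ++ₚ Q)

  last-edge : ∀ {e v} → Path G e v → ∃ λ f → tgt f ≡ v
  last-edge {e} [ p ]   = e , p
  last-edge     (_ ∷ P) = last-edge P

  module _ (acyclic : Acyclic G) where

    _⊏_ : Edge → Edge → Set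
    e ⊏ f = Path G e (src f)

    ⊏-isStrictPartialOrder : IsStrictPartialOrder _≡_ _⊏_
    ⊏-isStrictPartialOrder = record
      { isEquivalence = ≡.isEquivalence
      ; irrefl        = λ { {e} ≡.refl → acyclic e }
      ; trans         = _++ₚ_
      ; <-resp-≈      = (λ { ≡.refl P → P }) , (λ { ≡.refl P → P })
      }

    ⊏-wellFounded : WellFounded _⊏_
    ⊏-wellFounded = spo-wellFounded ⊏-isStrictPartialOrder

    -- An internal head always has an outgoing edge along which to continue. The order of the
    -- finitely many edges is Noetherian by acyclicity, so the walk stops, and it can stop only at
    -- the boundary.
    path-to-boundary : ∀ e → ∃ λ j → Path G e (boundary j)
    path-to-boundary e = go e (spo-noetherian ⊏-isStrictPartialOrder e)
      where
      go : ∀ e → Acc (flip _⊏_) e → ∃ λ j → Path G e (boundary j)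
      go e (acc rec) with tgt e in p
      ... | inj₁ j = j , [ p ]
      ... | inj₂ v with out-edge v
      ...   | f , q with go f (rec [ ≡.trans p (≡.sym q) ])
      ...     | j , P = j , ≡.trans p (≡.sym q) ∷ P

-- Constancy of the sign along paths with given ends.

module NetworkSigns (ℝ : RealField) {n} (N : Networks.PlabicNetwork ℝ n)
                    (ray : Networks.GaugeRayDirection ℝ N)
                    (acyclic : Acyclic (Networks.PlabicNetwork.graph N)) where
  open RealField ℝ using (0#; 1#; Carrier; _<_; _≤_; _*_; _-_; -_; _≈_; *-pos; <-respˡ-≈; <-respʳ-≈)
  module F = RealField ℝ
  open Networks ℝ hiding (module EdgeVectors)
  open Networks.EdgeVectors ℝ N ray
  open PlabicNetwork N
  open GaugeRayDirection ray
  open Disk disk using (start; end; clockwise)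
  open PlabicGraph isPlabic
  open Planar ℝ
  open Crossing 𝔩
  open ≡.≡-Reasoning

  private
    -0≈0 : - 0# ≈ 0#
    -0≈0 = RingProperties.-0#≈0# F.ring

    -- The direction of the boundary segment. Since the disk lies to its right, the negated cross
    -- product with `m` measures the height above the segment, up to scale.
    m : Point
    m = end -ₚ start

    height-boundary : ∀ j → cross m (pos (boundary j) -ₚ start) ≈ 0#
    height-boundary j = F.trans (cross-along m m start _ (parameter j) (boundary-position j))
      (F.trans (F.*-congˡ (cross-self m)) (F.zeroʳ _))

    height : ∀ v → 0# ≤ - cross m (pos v -ₚ start)
    height (inj₁ j) = inj₂ (F.sym (F.trans (F.-‿cong (height-boundary j)) -0≈0))
    height (inj₂ v) = inj₁ (neg⇒-pos (clockwise _ (internal-position v)))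

    relative-height : ∀ j p → cross m (p -ₚ pos (boundary j)) ≈ cross m (p -ₚ start)
    relative-height j p = F.trans (F.sym (cross-difference m p (pos (boundary j)) start))
      (F.trans (F.+-congˡ (F.trans (F.-‿cong (height-boundary j)) -0≈0)) (F.+-identityʳ _))

    inside : ∀ j v → 0# ≤ - cross m (pos v -ₚ pos (boundary j))
    inside j v = nonneg-resp (F.-‿cong (F.sym (relative-height j (pos v)))) (height v)

    outside : ∀ j v → 0# ≤ cross m (pos (boundary j) -ₚ pos v)
    outside j v = nonneg-resp (F.trans (F.sym (F.+-identityˡ _))
      (F.trans (F.+-congʳ (F.sym (height-boundary j)))
               (cross-difference m (pos (boundary j)) (pos v) start))) (height v)

    -- A ray from a boundary vertex starts at height zero and reaches an interior point, whose
    -- height is positive.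
    inward : Fin n → cross m 𝔩 < 0#
    inward j with pointing-inside j
    ... | t , 0<t , interior with cross m 𝔩 F.<? 0#
    ...   | yes neg = neg
    ...   | no ≮ = contradiction
        (<-respˡ-≈ (F.trans (F.sym (relative-height j _)) (cross-along m 𝔩 _ _ t (F.refl , F.refl)))
          (clockwise _ interior))
        (nonneg⇒≮0 (nonneg*nonneg (inj₁ 0<t) (≮0⇒nonneg ≮)))

    -- For internal vertices this is part of the choice of `𝔩`. Boundary vertices have height zero,
    -- while points of the open ray have positive height.
    not-on-ray : ∀ j v t → 0# < t → ¬ (pos v ≈ₚ pos (boundary j) +ₚ t · 𝔩)
    not-on-ray j (inj₂ v) t 0<t eq = no-internal-vertices j v t (inj₁ 0<t) eq
    not-on-ray j (inj₁ i) t 0<t eq = pos⇒≉0 (*-pos 0<t (neg⇒-pos (inward j)))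
      (F.trans (F.sym (RingProperties.-‿distribʳ-* F.ring t _))
        (F.trans (F.-‿cong (F.trans (F.sym (cross-along m 𝔩 _ _ t eq))
                             (F.trans (relative-height j _) (height-boundary i))))
          -0≈0))

    segment-avoids : ∀ v g → v ≢ src g → v ≢ tgt g →
      Avoids (pos (src g) -ₚ pos v) (pos (src g) -ₚ pos v) (pos (tgt g) -ₚ pos v)
    segment-avoids v g v≢s v≢t = off-segment⇒avoids off
      where
      off : ∀ t → InUnitInterval t → ¬ (pos v ≈ₚ pos (src g) +ₚ t · direction g)
      off t unit eq with vertices-on-edges v g (t , unit , eq)
      ... | inj₁ v≡s = v≢s v≡s
      ... | inj₂ v≡t = v≢t v≡t

    sideOf : Fin n → Vertex → Parity
    sideOf i v = side (pos v -ₚ pos (boundary i))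

    -- All vertices lie on the inner side of the boundary line, so `χ-inside` applies once
    -- `boundary i` is off the edge `g`. As a source it is not the head of `g`.
    χ-source : ∀ {d i} → src d ≡ boundary i → ∀ g → src g ≢ boundary i →
               χ (pos (src g) -ₚ pos (boundary i)) (pos (tgt g) -ₚ pos (boundary i))
                 ≡ sideOf i (src g) ℙ+ sideOf i (tgt g)
    χ-source {i = i} d-source g g≢ = HalfPlane.χ-inside m (inward i) _ _
      (inside i (src g)) (inside i (tgt g))
      (segment-avoids (boundary i) g (λ eq → g≢ (≡.sym eq)) λ eq → no-through (≡.sym eq) d-source)

    sourceList : List (Fin n)
    sourceList = filter (_∈? sources) (allFin n)

    sides : Vertex → Parity
    sides v = ∑ℙ sourceList λ i → sideOf i v

    int-parity : ∀ g → (∀ i → src g ≢ boundary i) →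
                 ℕ.parity (int g) ≡ sides (src g) ℙ+ sides (tgt g)
    int-parity g internal-src = parity-count
      (λ i → rayMeets? (pos (boundary i)) 𝔩 (pos (src g)) (direction g) (not-parallel g))
      _ _ sourceList λ {i} i∈ →
        let d , d-source = source⇒edge (proj₂ (List.∈-filter⁻ (_∈? sources) {xs = allFin n} i∈)) in
        ≡.trans (Ray.χ-ray (pos (boundary i)) (pos (src g)) (pos (tgt g))
                  (not-on-ray i (src g)) (not-on-ray i (tgt g)) (not-parallel g) _)
                (χ-source d-source g (internal-src i))

    intₚ-tail : ∀ {d f v} → tgt d ≡ src f → (Q : Path graph f v) →
                ℕ.parity (intₚ Q) ≡ sides (src f) ℙ+ sides v
    intₚ-tail {f = f} p [ q ] = ≡.trans (int-parity f (λ i eq → no-through (≡.trans p eq) eq))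
      (≡.cong (λ v → sides (src f) ℙ+ sides v) q)
    intₚ-tail {f = f} {v} p (_∷_ {f = g} q Q) = begin
      ℕ.parity (int f ℕ.+ intₚ Q)                     ≡⟨ Parity.+-homo-+ (int f) (intₚ Q) ⟩
      ℕ.parity (int f) ℙ+ ℕ.parity (intₚ Q)           ≡⟨ ≡.cong₂ _ℙ+_ (int-parity f λ i eq → no-through (≡.trans p eq) eq)
                                                           (intₚ-tail q Q) ⟩
      (sides (src f) ℙ+ sides (tgt f)) ℙ+ (sides (src g) ℙ+ sides v)
        ≡⟨ ≡.cong (λ w → (sides (src f) ℙ+ sides w) ℙ+ (sides (src g) ℙ+ sides v)) q ⟩
      (sides (src f) ℙ+ sides (src g)) ℙ+ (sides (src g) ℙ+ sides v)
        ≡⟨ cancel-middle (sides (src f)) (sides (src g)) (sides v) ⟩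
      sides (src f) ℙ+ sides v                        ∎

    -- Past the first edge no edge starts at the boundary, and changes of side telescope. The first
    -- edge may start at the base point of a gauge ray, so `int e` is kept as it is.
    intₚ-parity : ∀ {e v} (P : Path graph e v) →
                  ℕ.parity (intₚ P) ≡ ℕ.parity (int e) ℙ+ (sides (tgt e) ℙ+ sides v)
    intₚ-parity {e} [ ≡.refl ] = ≡.sym (≡.trans
      (≡.cong (ℕ.parity (int e) ℙ+_) (Parity.p+p≡0ℙ (sides (tgt e)))) (Parity.+-identityʳ _))
    intₚ-parity {e} {v} (p ∷ Q) = ≡.trans (Parity.+-homo-+ (int e) (intₚ Q))
      (≡.cong (ℕ.parity (int e) ℙ+_)
        (≡.trans (intₚ-tail p Q) (≡.cong (λ w → sides w ℙ+ sides v) (≡.sym p))))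

    -- The parity of the number of edges of the path that meet the ray from p.
    U : Point → ∀ {e v} → Path graph e v → Parity
    U p {e} [ _ ]   = χ (pos (src e) -ₚ p) (pos (tgt e) -ₚ p)
    U p {e} (_ ∷ Q) = χ (pos (src e) -ₚ p) (pos (tgt e) -ₚ p) ℙ+ U p Q

    -- Whether e meets the ray from v in the direction opposite to 𝔩.
    below : Edge → Vertex → Parity
    below e v = χ (pos v -ₚ pos (src e)) (pos v -ₚ pos (tgt e))

    -- The ray opposite to `𝔩` from a boundary vertex points out of the half plane that contains the
    -- network.
    below-boundary : ∀ e j → below e (boundary j) ≡ 0ℙ
    below-boundary e j = HalfPlane.χ-outside m (inward j) _ _ (outside j (src e)) (outside j (tgt e))

    -- `χ-corner` for the chord from the tail of `e` to the head of `f`, which is the sum of the two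
    -- directions.
    wind-parity : ∀ {e f} → tgt e ≡ src f →
      parityℤ (wind e f) ≡
      χ (pos (src f) -ₚ pos (src e)) (pos (tgt f) -ₚ pos (src e)) ℙ+ below e (tgt f)
    wind-parity {e} {f} p = ≡.trans (winding-parity (direction e) (direction f) (not-parallel e) (not-parallel f))
      (≡.sym (corner (pos (src e)) (pos (tgt e)) (pos (src f)) (pos (tgt f)) (≡.cong pos p)))
      where
      -- Both names of the common vertex become variables so that their equality can be matched with
      -- `refl`.
      corner : ∀ a b b′ c → b ≡ b′ →
               χ (b′ -ₚ a) (c -ₚ a) ℙ+ χ (c -ₚ a) (c -ₚ b) ≡ χ (b -ₚ a) (c -ₚ b′)
      corner a b b c ≡.refl = χ-corner (b -ₚ a) (c -ₚ b) (c -ₚ a) (-ₚ-telescope a b c)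

    -- e comes before f and f before g, so that e and g have no common vertex.
    apart : ∀ {e f g} → tgt e ≡ src f → Path graph f (src g) →
            ∀ t u → InUnitInterval t → InUnitInterval u →
            ¬ (pos (src e) +ₚ t · direction e ≈ₚ pos (src g) +ₚ u · direction g)
    apart {e} {f} {g} p B t u t-unit u-unit eq
      -- A common point would be a common vertex, and each of the four coincidences closes a
      -- directed cycle.
      with edges-disjoint (λ { ≡.refl → acyclic e (p ∷ B) }) _ (t , t-unit , F.refl , F.refl) (u , u-unit , eq)
    ... | v , inj₁ ve , inj₁ vg , _ = acyclic e (≡.subst (Path graph e) (≡.trans (≡.sym vg) ve) (p ∷ B))
    ... | v , inj₁ ve , inj₂ vg , _ = acyclic e (p ∷ (B ++ₚ [ ≡.trans (≡.sym vg) ve ]))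
    ... | v , inj₂ ve , inj₁ vg , _ = acyclic f (≡.subst (Path graph f) (≡.trans (≡.sym vg) (≡.trans ve p)) B)
    ... | v , inj₂ ve , inj₂ vg , _ = acyclic f (B ++ₚ [ ≡.trans (≡.sym vg) (≡.trans ve p) ])

    -- The sum of `χ-parallelogram` over the edges of `R`, with telescoping right-hand sides. The
    -- path to `src g` is extended along `R` and keeps each of its edges apart from `e`.
    U-shift : ∀ {e f g v} → tgt e ≡ src f → Path graph f (src g) → (R : Path graph g v) →
              U (pos (src e)) R ℙ+ U (pos (tgt e)) R ≡ below e (src g) ℙ+ below e v
    U-shift {e} {g = g} p B [ ≡.refl ] = χ-parallelogram (pos (src e)) (pos (tgt e)) (pos (src g)) (pos (tgt g)) (apart p B)
    U-shift {e} {g = g} {v} p B (_∷_ {f = h} q R) = begin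
      (χ (pos (src g) -ₚ pos (src e)) (pos (tgt g) -ₚ pos (src e)) ℙ+ U (pos (src e)) R) ℙ+
      (χ (pos (src g) -ₚ pos (tgt e)) (pos (tgt g) -ₚ pos (tgt e)) ℙ+ U (pos (tgt e)) R)
        ≡⟨ interchange (χ (pos (src g) -ₚ pos (src e)) (pos (tgt g) -ₚ pos (src e))) (U (pos (src e)) R)
                       (χ (pos (src g) -ₚ pos (tgt e)) (pos (tgt g) -ₚ pos (tgt e))) (U (pos (tgt e)) R) ⟩
      (χ (pos (src g) -ₚ pos (src e)) (pos (tgt g) -ₚ pos (src e)) ℙ+
       χ (pos (src g) -ₚ pos (tgt e)) (pos (tgt g) -ₚ pos (tgt e))) ℙ+
      (U (pos (src e)) R ℙ+ U (pos (tgt e)) R)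
        ≡⟨ ≡.cong₂ _ℙ+_ (χ-parallelogram (pos (src e)) (pos (tgt e)) (pos (src g)) (pos (tgt g)) (apart p B))
             (U-shift p (B ++ₚ [ q ]) R) ⟩
      (below e (src g) ℙ+ below e (tgt g)) ℙ+ (below e (src h) ℙ+ below e v)
        ≡⟨ ≡.cong (λ w → (below e (src g) ℙ+ below e w) ℙ+ (below e (src h) ℙ+ below e v)) q ⟩
      (below e (src g) ℙ+ below e (src h)) ℙ+ (below e (src h) ℙ+ below e v)
        ≡⟨ cancel-middle (below e (src g)) (below e (src h)) (below e v) ⟩
      below e (src g) ℙ+ below e v ∎

    -- The discrete counterpart of Hopf's Umlaufsatz for the simple path p ∷ Q:
    -- the difference of two points of the path turns from e to the last edge
    -- through the differences with the initial vertex, and then through those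
    -- with the final vertex.
    hopf : ∀ {e f j} (p : tgt e ≡ src f) (Q : Path graph f (boundary j)) →
           parityℤ (windₚ (p ∷ Q)) ≡ U (pos (src e)) Q
    hopf {e} {f} {j} p [ q ] = begin
      parityℤ (wind e f ℤ.+ ℤ.0ℤ)  ≡⟨ ≡.cong parityℤ (ℤ.+-identityʳ (wind e f)) ⟩
      parityℤ (wind e f)           ≡⟨ wind-parity p ⟩
      first ℙ+ below e (tgt f)     ≡⟨ ≡.cong (first ℙ+_) (≡.trans (≡.cong (below e) q) (below-boundary e j)) ⟩
      first ℙ+ 0ℙ                  ≡⟨ Parity.+-identityʳ first ⟩
      first                        ∎
      where first = χ (pos (src f) -ₚ pos (src e)) (pos (tgt f) -ₚ pos (src e))
    hopf {e} {f} {j} p (_∷_ {f = g} q R) = begin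
      parityℤ (wind e f ℤ.+ windₚ (q ∷ R))
        ≡⟨ parityℤ-+ (wind e f) (windₚ (q ∷ R)) ⟩
      parityℤ (wind e f) ℙ+ parityℤ (windₚ (q ∷ R))
        ≡⟨ ≡.cong₂ _ℙ+_ (wind-parity p) (hopf q R) ⟩
      (first ℙ+ below e (tgt f)) ℙ+ U (pos (src f)) R
        ≡⟨ Parity.+-assoc first (below e (tgt f)) (U (pos (src f)) R) ⟩
      first ℙ+ (below e (tgt f) ℙ+ U (pos (src f)) R)
        ≡⟨ ≡.cong (first ℙ+_) shift ⟩
      first ℙ+ U (pos (src e)) R ∎
      where
      first = χ (pos (src f) -ₚ pos (src e)) (pos (tgt f) -ₚ pos (src e))
      -- Induction leaves the base point at `src f`, which is `tgt e`. `U-shift` moves it back to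
      -- `src e`, and its term at the final vertex vanishes by `below-boundary`.
      shift : below e (tgt f) ℙ+ U (pos (src f)) R ≡ U (pos (src e)) R
      shift = begin
        below e (tgt f) ℙ+ U (pos (src f)) R
          ≡⟨ ≡.cong₂ _ℙ+_ (≡.trans (≡.cong (below e) q) (≡.sym (Parity.+-identityʳ _)))
                          (≡.cong (λ w → U (pos w) R) (≡.sym p)) ⟩
        (below e (src g) ℙ+ 0ℙ) ℙ+ U (pos (tgt e)) R
          ≡⟨ ≡.cong (λ x → (below e (src g) ℙ+ x) ℙ+ U (pos (tgt e)) R) (below-boundary e j) ⟨
        (below e (src g) ℙ+ below e (boundary j)) ℙ+ U (pos (tgt e)) R
          ≡⟨ ≡.cong (_ℙ+ U (pos (tgt e)) R) (U-shift p [ q ] R) ⟨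
        (U (pos (src e)) R ℙ+ U (pos (tgt e)) R) ℙ+ U (pos (tgt e)) R
          ≡⟨ Parity.+-assoc (U (pos (src e)) R) _ _ ⟩
        U (pos (src e)) R ℙ+ (U (pos (tgt e)) R ℙ+ U (pos (tgt e)) R)
          ≡⟨ ≡.cong (U (pos (src e)) R ℙ+_) (Parity.p+p≡0ℙ (U (pos (tgt e)) R)) ⟩
        U (pos (src e)) R ℙ+ 0ℙ
          ≡⟨ Parity.+-identityʳ _ ⟩
        U (pos (src e)) R ∎

    U-source : ∀ {d e f i v} → src d ≡ boundary i → tgt e ≡ src f → (Q : Path graph f v) →
               U (pos (boundary i)) Q ≡ sideOf i (src f) ℙ+ sideOf i v
    U-source {f = f} d-source p [ ≡.refl ] =
      χ-source d-source f λ eq → no-through (≡.trans p eq) eq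
    U-source {f = f} {i} {v} d-source p (_∷_ {f = g} q Q) = begin
      χ (pos (src f) -ₚ pos (boundary i)) (pos (tgt f) -ₚ pos (boundary i)) ℙ+ U (pos (boundary i)) Q
        ≡⟨ ≡.cong₂ _ℙ+_ (χ-source d-source f λ eq → no-through (≡.trans p eq) eq) (U-source d-source q Q) ⟩
      (sideOf i (src f) ℙ+ sideOf i (tgt f)) ℙ+ (sideOf i (src g) ℙ+ sideOf i v)
        ≡⟨ ≡.cong (λ w → (sideOf i (src f) ℙ+ sideOf i w) ℙ+ (sideOf i (src g) ℙ+ sideOf i v)) q ⟩
      (sideOf i (src f) ℙ+ sideOf i (src g)) ℙ+ (sideOf i (src g) ℙ+ sideOf i v)
        ≡⟨ cancel-middle (sideOf i (src f)) (sideOf i (src g)) (sideOf i v) ⟩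
      sideOf i (src f) ℙ+ sideOf i v ∎

    windₚ-from-source : ∀ {e i j} → src e ≡ boundary i → (P : Path graph e (boundary j)) →
                        parityℤ (windₚ P) ≡ sideOf i (tgt e) ℙ+ sideOf i (boundary j)
    windₚ-from-source {e} {i} {j} e-source [ p ] = ≡.sym (≡.trans
      (≡.cong (λ w → sideOf i w ℙ+ sideOf i (boundary j)) p) (Parity.p+p≡0ℙ (sideOf i (boundary j))))
    windₚ-from-source {e} {i} {j} e-source (_∷_ {f = f} p Q) = begin
      parityℤ (windₚ (p ∷ Q))   ≡⟨ hopf p Q ⟩
      U (pos (src e)) Q         ≡⟨ ≡.cong (λ w → U (pos w) Q) e-source ⟩
      U (pos (boundary i)) Q    ≡⟨ U-source e-source p Q ⟩
      sideOf i (src f) ℙ+ sideOf i (boundary j)  ≡⟨ ≡.cong (λ w → sideOf i w ℙ+ sideOf i (boundary j)) p ⟨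
      sideOf i (tgt e) ℙ+ sideOf i (boundary j)  ∎

    -- The recursion goes backwards through incoming edges until an edge starts at a boundary
    -- source. Each prepended edge `d` adds the same `wind d e` to both paths.
    windₚ-invariant : ∀ {e} → Acc (_⊏_ acyclic) e → ∀ {j} (P Q : Path graph e (boundary j)) →
                      parityℤ (windₚ P) ≡ parityℤ (windₚ Q)
    windₚ-invariant {e} (acc rec) P Q with src e in eq
    ... | inj₁ i = ≡.trans (windₚ-from-source eq P) (≡.sym (windₚ-from-source eq Q))
    ... | inj₂ v with in-edge v
    ...   | d , p = Parity.+-cancelˡ-≡ (parityℤ (wind d e)) _ _ (begin
        parityℤ (wind d e) ℙ+ parityℤ (windₚ P)   ≡⟨ parityℤ-+ (wind d e) (windₚ P) ⟨
        parityℤ (windₚ (d→e ∷ P))                 ≡⟨ windₚ-invariant (rec [ p ]) (d→e ∷ P) (d→e ∷ Q) ⟩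
        parityℤ (windₚ (d→e ∷ Q))                 ≡⟨ parityℤ-+ (wind d e) (windₚ Q) ⟩
        parityℤ (wind d e) ℙ+ parityℤ (windₚ Q)   ∎)
      where
      d→e : tgt d ≡ src e
      d→e = ≡.trans p (≡.sym eq)

  exponent-invariant : ∀ {e j} (P Q : Path graph e (boundary j)) →
                       parityℤ (exponent P) ≡ parityℤ (exponent Q)
  exponent-invariant {e} P Q = begin
    parityℤ (exponent P)                            ≡⟨ parityℤ-+ (windₚ P) (ℤ.+ intₚ P) ⟩
    parityℤ (windₚ P) ℙ+ ℕ.parity (intₚ P)          ≡⟨ ≡.cong₂ _ℙ+_
      (windₚ-invariant (⊏-wellFounded acyclic e) P Q) (≡.trans (intₚ-parity P) (≡.sym (intₚ-parity Q))) ⟩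
    parityℤ (windₚ Q) ℙ+ ℕ.parity (intₚ Q)          ≡⟨ parityℤ-+ (windₚ Q) (ℤ.+ intₚ Q) ⟨
    parityℤ (exponent Q)                            ∎

-- Finite sums and combinations of basis vectors.

module Sums (ℝ : RealField) where
  open RealField ℝ
  open Networks ℝ using (∑; sign; basis; combination)
  open Planar ℝ using (pos⇒≉0; pos+nonneg)
  open RingProperties ring using (-‿distribˡ-*; -0#≈0#; -‿involutive)
  open import Relation.Binary.Reasoning.Setoid setoid

  ∑-*ˡ : ∀ {A : Set} c (xs : List A) {f g : A → Carrier} → (∀ x → f x ≈ c * g x) →
         ∑ xs f ≈ c * ∑ xs g
  ∑-*ˡ c []       eq = sym (zeroʳ c)
  ∑-*ˡ c (x ∷ xs) eq = trans (+-cong (eq x) (∑-*ˡ c xs eq)) (sym (distribˡ c _ _))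

  ∑-nonneg : ∀ {A : Set} (xs : List A) {f : A → Carrier} → (∀ x → 0# < f x) → 0# ≤ ∑ xs f
  ∑-nonneg []       pos = inj₂ refl
  ∑-nonneg (x ∷ xs) pos = inj₁ (pos+nonneg (pos x) (∑-nonneg xs pos))

  ∑-pos : ∀ {A : Set} {x : A} {xs} {f : A → Carrier} → x List.∈ xs → (∀ x → 0# < f x) → 0# < ∑ xs f
  ∑-pos {xs = y ∷ ys} _ pos = pos+nonneg (pos y) (∑-nonneg ys pos)

  ∑-empty : ∀ {A : Set} (xs : List A) {f : A → Carrier} → ¬ A → ∑ xs f ≈ 0#
  ∑-empty []      _  = refl
  ∑-empty (x ∷ _) ¬A = contradiction x ¬A

  sign*≈0 : ∀ p {x} → sign p * x ≈ 0# → x ≈ 0#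
  sign*≈0 0ℙ {x} eq = trans (sym (*-identityˡ x)) eq
  sign*≈0 1ℙ {x} eq = begin
    x              ≈⟨ sym (*-identityˡ x) ⟩
    1# * x         ≈⟨ sym (-‿involutive _) ⟩
    - - (1# * x)   ≈⟨ -‿cong (trans (-‿distribˡ-* 1# x) eq) ⟩
    - 0#           ≈⟨ -0#≈0# ⟩
    0#             ∎

  module _ {n} (a : Fin n → Carrier) (i : Fin n) where

    private
      term : Fin n → Carrier
      term j = a j * basis j i

      term-≢ : ∀ {j} → i ≢ j → term j ≈ 0#
      term-≢ {j} i≢j with i Fin.≟ j
      ... | yes i≡j = contradiction i≡j i≢j
      ... | no _    = zeroʳ (a j)

      term-≡ : term i ≈ a i
      term-≡ with i Fin.≟ i
      ... | yes _  = *-identityʳ (a i)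
      ... | no i≢i = contradiction ≡.refl i≢i

      ∑-∉ : ∀ xs → ¬ (i List.∈ xs) → ∑ xs term ≈ 0#
      ∑-∉ []       _  = refl
      ∑-∉ (j ∷ xs) i∉ = trans (+-cong (term-≢ λ i≡j → i∉ (here i≡j)) (∑-∉ xs λ i∈ → i∉ (there i∈)))
                              (+-identityˡ 0#)

      ∑-∈ : ∀ {xs} → Unique xs → i List.∈ xs → ∑ xs term ≈ a i
      ∑-∈ (i∉ ∷ _) (here ≡.refl) =
        trans (+-cong term-≡ (∑-∉ _ λ i∈ → All.lookup i∉ i∈ ≡.refl)) (+-identityʳ (a i))
      ∑-∈ (j∉ ∷ uniq) (there i∈) =
        trans (+-cong (term-≢ λ i≡j → All.lookup j∉ i∈ (≡.sym i≡j)) (∑-∈ uniq i∈)) (+-identityˡ (a i))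

    combination-∈ : ∀ J → i ∈ J → combination J a i ≈ a i
    combination-∈ J i∈J = ∑-∈ (Unique.filter⁺ (_∈? J) (Unique.allFin⁺ n))
                              (List.∈-filter⁺ (_∈? J) (List.∈-allFin i) i∈J)

    combination-∉ : ∀ J → i ∉ J → combination J a i ≈ 0#
    combination-∉ J i∉J = ∑-∉ _ λ i∈ → i∉J (proj₂ (List.∈-filter⁻ (_∈? J) {xs = allFin n} i∈))

-- The formula for edge vectors and their non-vanishing.

module Formula (ℝ : RealField) {n} (N : Networks.PlabicNetwork ℝ n)
               (ray : Networks.GaugeRayDirection ℝ N)
               (acyclic : Acyclic (Networks.PlabicNetwork.graph N)) where
  open RealField ℝ using (Carrier; 0#; _<_; _≈_; _*_; *-pos; *-congʳ; sym; trans; reflexive)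
  open Networks ℝ using (module PlabicNetwork; ∑; sign; combination; _≈ᵛ_)
  open Networks.EdgeVectors ℝ N ray
  open PlabicNetwork N
  open PlabicGraph isPlabic
  open NetworkSigns ℝ N ray acyclic using (exponent-invariant)
  open Planar ℝ using (pos⇒≉0)
  open Sums ℝ

  private
    -- Any path can represent the common parity. If there is none, the sum over the flows is empty
    -- and the default `0ℙ` multiplies zero.
    firstParity : ∀ {e j} → List (Path graph e (boundary j)) → Parity
    firstParity []      = 0ℙ
    firstParity (P ∷ _) = parityℤ (exponent P)

    σ : Edge → Fin n → Parity
    σ e j = firstParity (paths e (boundary j))

    exponent-σ : ∀ {e j} (P : Path graph e (boundary j)) → parityℤ (exponent P) ≡ σ e j
    exponent-σ {e} {j} P = first (paths e (boundary j)) (paths-complete acyclic P)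
      where
      first : ∀ xs → P List.∈ xs → parityℤ (exponent P) ≡ firstParity xs
      first (Q ∷ _) _ = exponent-invariant P Q

    weightₚ-pos : ∀ {e v} (P : Path graph e v) → 0# < weightₚ P
    weightₚ-pos {e} [ _ ]   = weight-positive e
    weightₚ-pos {e} (_ ∷ P) = *-pos (weight-positive e) (weightₚ-pos P)

    edgeVector-sign : ∀ e j → edgeVector e j ≈ sign (σ e j) * ∑ (flows e j) weightₚ
    edgeVector-sign e j = ∑-*ˡ (sign (σ e j)) (paths e (boundary j))
      λ P → *-congʳ (reflexive (≡.cong sign (exponent-σ P)))

    -- A path to a boundary source would enter it by its last edge, which `no-through` forbids.
    edgeVector-source : ∀ e j → j ∉ ∁ sources → edgeVector e j ≈ 0#
    edgeVector-source e j j∉ = ∑-empty (paths e (boundary j)) λ P →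
      let f , into = last-edge P
          d , from = source⇒edge (x∉∁p⇒x∈p j∉)
      in no-through into from

    edgeVector-combination : ∀ e {a : Fin n → Carrier} → (∀ j → edgeVector e j ≈ a j) →
                             edgeVector e ≈ᵛ combination (∁ sources) a
    edgeVector-combination e {a} eq j with j ∈? ∁ sources
    ... | yes j∈ = trans (eq j) (sym (combination-∈ a j (∁ sources) j∈))
    ... | no j∉  = trans (edgeVector-source e j j∉) (sym (combination-∉ a j (∁ sources) j∉))

  -- At a boundary vertex reached from `e` the component is, up to sign, a nonempty sum of positive
  -- weights.
  edgeVectors-nonNull : EdgeVectorsNonNull
  edgeVectors-nonNull e null with path-to-boundary acyclic e
  ... | j , P = pos⇒≉0 (∑-pos (paths-complete acyclic P) weightₚ-pos)
    (sign*≈0 (σ e j) (trans (sym (edgeVector-sign e j)) (null j)))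

  edgeVector-formula : EdgeVectorFormula
  edgeVector-formula = σ , (λ _ _ _ → exponent-σ) ,
    (λ e → edgeVector-combination e λ _ → RealField.refl ℝ) ,
    (λ e → edgeVector-combination e (edgeVector-sign e))

-- Acyclicity of Le-networks.

module LeGraph {k m} (L : LeDiagram k m) where

  private
    box : Fin k → Fin m → ℕ
    box r c = toℕ r ℕ.+ (m ℕ.∸ suc (toℕ c))

  -- `box` counts the steps down and left from the northeast corner. It is doubled to make room for
  -- the white vertex between the black one and the next box. A source stays below the boxes of its
  -- row, and the value at sinks exceeds that of every box.
  potential : LeVertex L → ℕ
  potential (source r)       = 2 ℕ.* toℕ r
  potential (sink c)         = 1 ℕ.+ 2 ℕ.* (k ℕ.+ m)
  potential (single r c _ _) = 1 ℕ.+ 2 ℕ.* box r c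
  potential (black r c _)    = 1 ℕ.+ 2 ℕ.* box r c
  potential (white r c _)    = 2 ℕ.+ 2 ℕ.* box r c

  private
    entry : ∀ {r c v} → Entry L r c v → potential v ≡ 1 ℕ.+ 2 ℕ.* box r c
    entry single = ≡.refl
    entry black  = ≡.refl

    exit : ∀ {r c v} → Exit L r c v → potential v ℕ.≤ 2 ℕ.+ 2 ℕ.* box r c
    exit single = ℕ.n≤1+n _
    exit white  = ℕ.≤-refl

    double : ∀ {x y} → x ℕ.< y → 2 ℕ.+ 2 ℕ.* x ℕ.≤ 2 ℕ.* y
    double {x} {y} x<y = ≡.subst (ℕ._≤ 2 ℕ.* y) (ℕ.*-suc 2 x) (ℕ.*-monoʳ-≤ 2 x<y)

    exit-entry : ∀ {r c r′ c′ u v} → Exit L r c u → Entry L r′ c′ v → box r c ℕ.< box r′ c′ →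
                 potential u ℕ.< potential v
    exit-entry {r′ = r′} {c′} x y lt rewrite entry y =
      ℕ.s≤s (ℕ.≤-trans (exit x) (double lt))

  arc-increases : ∀ {κ u v} → LeArc L κ u v → potential u ℕ.< potential v
  arc-increases (from-source {r} y _) rewrite entry y =
    ℕ.s≤s (ℕ.*-monoʳ-≤ 2 (ℕ.m≤m+n (toℕ r) _))
  arc-increases (leftwards {r} {c} {c′} x y c′<c _) = exit-entry x y
    (ℕ.+-monoʳ-< (toℕ r) (ℕ.∸-monoʳ-< (ℕ.s≤s c′<c) (Fin.toℕ<n c)))
  arc-increases (downwards {r} {r′} {c} x y r<r′ _) = exit-entry x y
    (ℕ.+-monoˡ-< _ r<r′)
  arc-increases (to-sink {r} {c} x _) =
    ℕ.s≤s (ℕ.≤-trans (exit x) (double (ℕ.+-mono-<-≤ (Fin.toℕ<n r) (ℕ.m∸n≤m m (suc (toℕ c))))))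
  arc-increases resolved = ℕ.n<1+n _

open Networks
open PlabicNetwork using (graph)
open EdgeVectors using (EdgeVectorsNonNull; EdgeVectorFormula)

-- The inverse of `place` carries the potential over to the network. It increases strictly along
-- every path, so no path closes up.
Le⇒acyclic : (ℝ : RealField) {n : ℕ} {N : PlabicNetwork ℝ n} →
             IsLeNetwork ℝ N → Acyclic (graph N)
Le⇒acyclic ℝ {N = N} le e P = ℕ.<-irrefl ≡.refl (path-increases P)
  where
  open PlabicNetwork N hiding (graph)
  open IsLeNetwork le
  open LeGraph leDiagram

  level : Vertex → ℕ
  level v = potential (proj₁ (proj₂ place-bijective v))

  -- Surjectivity yields some preimage of `place u`; injectivity identifies it with `u`.
  level-place : ∀ u → level (place u) ≡ potential u
  level-place u = ≡.cong potential
    (proj₁ place-bijective (proj₂ (proj₂ place-bijective (place u)) ≡.refl))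

  edge-increases : ∀ e → level (src e) ℕ.< level (tgt e)
  edge-increases e with edge⇒arc e
  ... | _ , u , v , arc , p , q = ≡.subst₂ ℕ._<_
    (≡.trans (≡.sym (level-place u)) (≡.cong level p))
    (≡.trans (≡.sym (level-place v)) (≡.cong level q)) (arc-increases arc)

  path-increases : ∀ {e v} → Path (graph N) e v → level (src e) ℕ.< level v
  path-increases {e} [ ≡.refl ] = edge-increases e
  path-increases {e} (p ∷ P) = ℕ.<-trans (edge-increases e)
    (≡.subst (λ w → level w ℕ.< _) (≡.sym p) (path-increases P))

theorem6p1 : (ℝ : RealField) →
    ((n : ℕ) (N : PlabicNetwork ℝ n) (ray : GaugeRayDirection ℝ N) →
    Acyclic (graph N) →
    Digraph.NoInternalSourcesOrSinks (graph N) →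
    Irreducible (graph N) →
    EdgeVectorsNonNull ℝ N ray × EdgeVectorFormula ℝ N ray)
    ×
    ((n : ℕ) (N : PlabicNetwork ℝ n) (ray : GaugeRayDirection ℝ N) →
    IsLeNetwork ℝ N →
    Irreducible (graph N) →
    EdgeVectorFormula ℝ N ray)
theorem6p1 ℝ =
  (λ _ N ray acyclic _ _ → Formula.edgeVectors-nonNull ℝ N ray acyclic ,
                           Formula.edgeVector-formula ℝ N ray acyclic) ,
  (λ _ N ray le _ → Formula.edgeVector-formula ℝ N ray (Le⇒acyclic ℝ le))
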